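{- Let $F$ be a simple graph of order $n\ge 1$, let $V_k=\{v_1,\ldots,v_k\}\subseteq V(F)$ with $|V_k|=k$, and let $H_v$ be a simple graph of order $m\ge 2$ with a specified vertex $v$ of degree $m-1$. Put $H_1=H_v-v$ and $G=G[F,V_k,H_v]$. Order the vertices of $F$ so that $v_1,\ldots,v_k$ come first. Then the characteristic polynomial of the signless Laplacian matrix of $G$ is $$f_{Q(G)}(x)=\bigl(f_{Q(H_1)}(x-1)\bigr)^k\det(xI_n-M),\qquad M=Q(F)+\bigl(m-1+\Gamma_{Q(H_1)}(x-1)\bigr)\begin{pmatrix} I_k & 0\\ 0&0\end{pmatrix},$$ where the block matrix is $n\times n$.
   Context: All graphs are finite and simple. For a graph $X$, $Q(X)=D(X)+A(X)$ is the signless Laplacian matrix, where $D(X)$ is the diagonal matrix of degrees and $A(X)$ the adjacency matrix. For a square matrix $N$ of order $s$, $f_N(x)=\det(xI_s-N)$ is its characteristic polynomial, and its coronal is $\Gamma_N(x)=\mathbf 1_s^T(xI_s-N)^{ -1}\mathbf 1_s$, a rational function of $x$, where $\mathbf 1_s$ is the all-ones column vector; the identity is an identity of rational functions in $x$. Graph with $k$ pockets: $G[F,V_k,H_v]$ is obtained by taking one copy of $F$ and $k$ vertex-disjoint copies of $H_v$, and, for each $i=1,\ldots,k$, identifying the vertex $v$ of the $i$th copy of $H_v$ with the vertex $v_i$ of $F$. -}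

module Defs where

open import Level using (Level; 0ℓ; _⊔_) renaming (suc to lsuc)
open import Algebra.Bundles using (CommutativeRing; CommutativeSemiring; Semiring)
open import Data.Bool.Base using (Bool; true; false; _∧_; if_then_else_)
open import Data.Bool.Properties using (∧-zeroʳ)
open import Data.Empty using (⊥-elim)
open import Data.Fin.Base using (Fin; zero; suc; toℕ; punchIn; splitAt; remQuot)
open import Data.Fin.Permutation using (Permutation′; _⟨$⟩ʳ_)
import Data.Fin.Properties as Fin
open import Data.List.Base using (List; []; _∷_; map)
open import Data.Nat.Base as ℕ using (ℕ; zero; suc)
import Data.Nat.Properties as ℕ
open import Data.Product.Base using (_×_; _,_)
import Data.Rational.Base as ℚ
import Data.Rational.Properties as ℚ
open import Data.Sum.Base as Sum using (_⊎_; inj₁; inj₂; [_,_]′)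
open import Data.Vec.Functional using (foldr)
open import Function.Base using (_∘_)
open import Relation.Binary.PropositionalEquality as ≡ using (_≡_)
open import Relation.Nullary using (¬_; Dec; yes; no)
open import Relation.Nullary.Decidable using (⌊_⌋)

record DiscreteDomain c ℓ : Set (lsuc (c ⊔ ℓ)) where
  field
    commutativeRing : CommutativeRing c ℓ
  open CommutativeRing commutativeRing public
  field
    1≉0            : ¬ (1# ≈ 0#)
    _≟0            : ∀ a → Dec (a ≈ 0#)
    noZeroDivisors : ∀ a b → a * b ≈ 0# → a ≈ 0# ⊎ b ≈ 0#

-- The reciprocal is total, with value 0# at 0#.
record DiscreteField c ℓ : Set (lsuc (c ⊔ ℓ)) where
  field
    commutativeRing : CommutativeRing c ℓ
  open CommutativeRing commutativeRing public
  infix 8 _⁻¹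
  field
    1≉0     : ¬ (1# ≈ 0#)
    _≟0     : ∀ a → Dec (a ≈ 0#)
    _⁻¹     : Carrier → Carrier
    inverse : ∀ a → ¬ (a ≈ 0#) → a * a ⁻¹ ≈ 1#
    0⁻¹     : ∀ a → a ≈ 0# → a ⁻¹ ≈ 0#

-- Polynomials are coefficient lists, constant term first; trailing zeros are
-- immaterial because equality compares coefficients.
module Polynomials {c ℓ} (D : DiscreteDomain c ℓ) where

  open DiscreteDomain D
  open import Relation.Binary.Reasoning.Setoid setoid
  open import Algebra.Properties.Ring ring using (-0#≈0#)
  open import Algebra.Properties.CommutativeSemigroup +-commutativeSemigroup
    using () renaming (interchange to +-interchange)

  Poly : Set c
  Poly = List Carrier

  coeff : Poly → ℕ → Carrier
  coeff []      n       = 0#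
  coeff (a ∷ p) zero    = a
  coeff (a ∷ p) (suc n) = coeff p n

  infix 4 _≈ₚ_
  record _≈ₚ_ (p q : Poly) : Set ℓ where
    constructor coeffwise
    field coeff≈ : ∀ n → coeff p n ≈ coeff q n
  open _≈ₚ_ public

  infixl 6 _+ₚ_
  infixl 7 _*ₚ_ _·_

  _+ₚ_ : Poly → Poly → Poly
  []      +ₚ q       = q
  (a ∷ p) +ₚ []      = a ∷ p
  (a ∷ p) +ₚ (b ∷ q) = a + b ∷ p +ₚ q

  -ₚ_ : Poly → Poly
  -ₚ_ = map (-_)

  _·_ : Carrier → Poly → Poly
  a · p = map (a *_) p

  _*ₚ_ : Poly → Poly → Poly
  []      *ₚ q = []
  (a ∷ p) *ₚ q = a · q +ₚ (0# ∷ p *ₚ q)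

  0ₚ 1ₚ X : Poly
  0ₚ = []
  1ₚ = 1# ∷ []
  X  = 0# ∷ 1# ∷ []

  coeff-+ : ∀ p q n → coeff (p +ₚ q) n ≈ coeff p n + coeff q n
  coeff-+ []      q       n       = sym (+-identityˡ _)
  coeff-+ (a ∷ p) []      n       = sym (+-identityʳ _)
  coeff-+ (a ∷ p) (b ∷ q) zero    = refl
  coeff-+ (a ∷ p) (b ∷ q) (suc n) = coeff-+ p q n

  coeff-· : ∀ a p n → coeff (a · p) n ≈ a * coeff p n
  coeff-· a []      n       = sym (zeroʳ a)
  coeff-· a (b ∷ p) zero    = refl
  coeff-· a (b ∷ p) (suc n) = coeff-· a p n

  coeff-neg : ∀ p n → coeff (-ₚ p) n ≈ - coeff p n
  coeff-neg []      n       = sym -0#≈0#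
  coeff-neg (b ∷ p) zero    = refl
  coeff-neg (b ∷ p) (suc n) = coeff-neg p n

  reflₚ : ∀ {p} → p ≈ₚ p
  reflₚ = coeffwise λ n → refl

  symₚ : ∀ {p q} → p ≈ₚ q → q ≈ₚ p
  symₚ e = coeffwise λ n → sym (coeff≈ e n)

  transₚ : ∀ {p q r} → p ≈ₚ q → q ≈ₚ r → p ≈ₚ r
  transₚ e f = coeffwise λ n → trans (coeff≈ e n) (coeff≈ f n)

  ∷-cong : ∀ {a b p q} → a ≈ b → p ≈ₚ q → (a ∷ p) ≈ₚ (b ∷ q)
  ∷-cong e f = coeffwise λ { zero → e ; (suc n) → coeff≈ f n }

  +ₚ-cong : ∀ {p p′ q q′} → p ≈ₚ p′ → q ≈ₚ q′ → p +ₚ q ≈ₚ p′ +ₚ q′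
  +ₚ-cong {p} {p′} {q} {q′} e f = coeffwise λ n → begin
    coeff (p +ₚ q) n         ≈⟨ coeff-+ p q n ⟩
    coeff p n + coeff q n    ≈⟨ +-cong (coeff≈ e n) (coeff≈ f n) ⟩
    coeff p′ n + coeff q′ n  ≈⟨ coeff-+ p′ q′ n ⟨
    coeff (p′ +ₚ q′) n       ∎

  -ₚ-cong : ∀ {p q} → p ≈ₚ q → -ₚ p ≈ₚ -ₚ q
  -ₚ-cong {p} {q} e = coeffwise λ n →
    trans (coeff-neg p n) (trans (-‿cong (coeff≈ e n)) (sym (coeff-neg q n)))

  +ₚ-comm : ∀ p q → p +ₚ q ≈ₚ q +ₚ p
  +ₚ-comm p q = coeffwise λ n →
    trans (coeff-+ p q n) (trans (+-comm _ _) (sym (coeff-+ q p n)))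

  +ₚ-assoc : ∀ p q r → (p +ₚ q) +ₚ r ≈ₚ p +ₚ (q +ₚ r)
  +ₚ-assoc p q r = coeffwise λ n → begin
    coeff ((p +ₚ q) +ₚ r) n              ≈⟨ coeff-+ (p +ₚ q) r n ⟩
    coeff (p +ₚ q) n + coeff r n         ≈⟨ +-congʳ (coeff-+ p q n) ⟩
    (coeff p n + coeff q n) + coeff r n  ≈⟨ +-assoc _ _ _ ⟩
    coeff p n + (coeff q n + coeff r n)  ≈⟨ +-congˡ (coeff-+ q r n) ⟨
    coeff p n + coeff (q +ₚ r) n         ≈⟨ coeff-+ p (q +ₚ r) n ⟨
    coeff (p +ₚ (q +ₚ r)) n              ∎

  +ₚ-identityʳ : ∀ p → p +ₚ 0ₚ ≈ₚ p
  +ₚ-identityʳ p = coeffwise λ n → trans (coeff-+ p [] n) (+-identityʳ _)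

  -ₚ-inverseʳ : ∀ p → p +ₚ (-ₚ p) ≈ₚ 0ₚ
  -ₚ-inverseʳ p = coeffwise λ n →
    trans (coeff-+ p (-ₚ p) n) (trans (+-congˡ (coeff-neg p n)) (-‿inverseʳ _))

  interchange : ∀ p q r s → (p +ₚ q) +ₚ (r +ₚ s) ≈ₚ (p +ₚ r) +ₚ (q +ₚ s)
  interchange p q r s = coeffwise λ n → begin
    coeff ((p +ₚ q) +ₚ (r +ₚ s)) n                       ≈⟨ split p q r s n ⟩
    (coeff p n + coeff q n) + (coeff r n + coeff s n)    ≈⟨ +-interchange _ _ _ _ ⟩
    (coeff p n + coeff r n) + (coeff q n + coeff s n)    ≈⟨ split p r q s n ⟨
    coeff ((p +ₚ r) +ₚ (q +ₚ s)) n                       ∎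
    where
    split : ∀ p q r s n → coeff ((p +ₚ q) +ₚ (r +ₚ s)) n ≈
                          (coeff p n + coeff q n) + (coeff r n + coeff s n)
    split p q r s n = trans (coeff-+ (p +ₚ q) (r +ₚ s) n)
                            (+-cong (coeff-+ p q n) (coeff-+ r s n))

  0∷-+ : ∀ p q → (0# ∷ p +ₚ q) ≈ₚ (0# ∷ p) +ₚ (0# ∷ q)
  0∷-+ p q = ∷-cong (sym (+-identityˡ 0#)) reflₚ

  ·-cong : ∀ {a b p q} → a ≈ b → p ≈ₚ q → a · p ≈ₚ b · q
  ·-cong {a} {b} {p} {q} e f = coeffwise λ n →
    trans (coeff-· a p n) (trans (*-cong e (coeff≈ f n)) (sym (coeff-· b q n)))

  ·-distribˡ : ∀ a p q → a · (p +ₚ q) ≈ₚ a · p +ₚ a · q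
  ·-distribˡ a p q = coeffwise λ n → begin
    coeff (a · (p +ₚ q)) n               ≈⟨ coeff-· a (p +ₚ q) n ⟩
    a * coeff (p +ₚ q) n                 ≈⟨ *-congˡ (coeff-+ p q n) ⟩
    a * (coeff p n + coeff q n)          ≈⟨ distribˡ _ _ _ ⟩
    a * coeff p n + a * coeff q n        ≈⟨ +-cong (coeff-· a p n) (coeff-· a q n) ⟨
    coeff (a · p) n + coeff (a · q) n    ≈⟨ coeff-+ (a · p) (a · q) n ⟨
    coeff (a · p +ₚ a · q) n             ∎

  ·-distribʳ : ∀ a b p → (a + b) · p ≈ₚ a · p +ₚ b · p
  ·-distribʳ a b p = coeffwise λ n → begin
    coeff ((a + b) · p) n                ≈⟨ coeff-· (a + b) p n ⟩
    (a + b) * coeff p n                  ≈⟨ distribʳ _ _ _ ⟩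
    a * coeff p n + b * coeff p n        ≈⟨ +-cong (coeff-· a p n) (coeff-· b p n) ⟨
    coeff (a · p) n + coeff (b · p) n    ≈⟨ coeff-+ (a · p) (b · p) n ⟨
    coeff (a · p +ₚ b · p) n             ∎

  ·-assoc : ∀ a b p → (a * b) · p ≈ₚ a · (b · p)
  ·-assoc a b p = coeffwise λ n → begin
    coeff ((a * b) · p) n  ≈⟨ coeff-· (a * b) p n ⟩
    (a * b) * coeff p n    ≈⟨ *-assoc _ _ _ ⟩
    a * (b * coeff p n)    ≈⟨ *-congˡ (coeff-· b p n) ⟨
    a * coeff (b · p) n    ≈⟨ coeff-· a (b · p) n ⟨
    coeff (a · (b · p)) n  ∎

  ·-zeroˡ : ∀ {a} p → a ≈ 0# → a · p ≈ₚ 0ₚ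
  ·-zeroˡ {a} p e = coeffwise λ n →
    trans (coeff-· a p n) (trans (*-congʳ e) (zeroˡ _))

  ·-identity : ∀ p → 1# · p ≈ₚ p
  ·-identity p = coeffwise λ n → trans (coeff-· 1# p n) (*-identityˡ _)

  0∷≈0 : ∀ {a p} → a ≈ 0# → p ≈ₚ 0ₚ → (a ∷ p) ≈ₚ 0ₚ
  0∷≈0 e f = coeffwise λ { zero → e ; (suc n) → coeff≈ f n }

  *ₚ-congˡ : ∀ p {q q′} → q ≈ₚ q′ → p *ₚ q ≈ₚ p *ₚ q′
  *ₚ-congˡ []      e = reflₚ
  *ₚ-congˡ (a ∷ p) e = +ₚ-cong (·-cong refl e) (∷-cong refl (*ₚ-congˡ p e))

  *ₚ-zeroʳ : ∀ p → p *ₚ [] ≈ₚ []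
  *ₚ-zeroʳ []      = reflₚ
  *ₚ-zeroʳ (a ∷ p) = 0∷≈0 refl (*ₚ-zeroʳ p)

  *ₚ-∷ʳ : ∀ p b q → p *ₚ (b ∷ q) ≈ₚ b · p +ₚ (0# ∷ p *ₚ q)
  *ₚ-∷ʳ []      b q = symₚ (0∷≈0 refl reflₚ)
  *ₚ-∷ʳ (a ∷ p) b q = ∷-cong (+-congʳ (*-comm a b))
    (transₚ (+ₚ-cong (reflₚ {a · q}) (*ₚ-∷ʳ p b q))
    (transₚ (symₚ (+ₚ-assoc (a · q) (b · p) _))
    (transₚ (+ₚ-cong (+ₚ-comm (a · q) (b · p)) reflₚ)
            (+ₚ-assoc (b · p) (a · q) _))))

  *ₚ-comm : ∀ p q → p *ₚ q ≈ₚ q *ₚ p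
  *ₚ-comm []      q = symₚ (*ₚ-zeroʳ q)
  *ₚ-comm (a ∷ p) q =
    transₚ (+ₚ-cong (reflₚ {a · q}) (∷-cong refl (*ₚ-comm p q))) (symₚ (*ₚ-∷ʳ q a p))

  *ₚ-cong : ∀ {p p′ q q′} → p ≈ₚ p′ → q ≈ₚ q′ → p *ₚ q ≈ₚ p′ *ₚ q′
  *ₚ-cong {p} {p′} {q} {q′} e f =
    transₚ (*ₚ-congˡ p f) (transₚ (*ₚ-comm p q′)
    (transₚ (*ₚ-congˡ q′ e) (*ₚ-comm q′ p′)))

  *ₚ-distribˡ : ∀ p q r → p *ₚ (q +ₚ r) ≈ₚ p *ₚ q +ₚ p *ₚ r
  *ₚ-distribˡ []      q r = reflₚ
  *ₚ-distribˡ (a ∷ p) q r = transₚ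
    (+ₚ-cong (·-distribˡ a q r)
      (transₚ (∷-cong refl (*ₚ-distribˡ p q r)) (0∷-+ (p *ₚ q) (p *ₚ r))))
    (interchange (a · q) (a · r) (0# ∷ p *ₚ q) (0# ∷ p *ₚ r))

  *ₚ-distribʳ : ∀ r p q → (p +ₚ q) *ₚ r ≈ₚ p *ₚ r +ₚ q *ₚ r
  *ₚ-distribʳ r p q = transₚ (*ₚ-comm (p +ₚ q) r)
    (transₚ (*ₚ-distribˡ r p q) (+ₚ-cong (*ₚ-comm r p) (*ₚ-comm r q)))

  ·-*ₚ : ∀ a p q → (a · p) *ₚ q ≈ₚ a · (p *ₚ q)
  ·-*ₚ a []      q = reflₚ
  ·-*ₚ a (b ∷ p) q = transₚ
    (+ₚ-cong (·-assoc a b q) (∷-cong (sym (zeroʳ a)) (·-*ₚ a p q)))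
    (symₚ (·-distribˡ a (b · q) (0# ∷ p *ₚ q)))

  0∷-*ₚ : ∀ {a} p q → a ≈ 0# → (a ∷ p) *ₚ q ≈ₚ 0# ∷ p *ₚ q
  0∷-*ₚ p q e = +ₚ-cong (·-zeroˡ q e) reflₚ

  *ₚ-assoc : ∀ p q r → (p *ₚ q) *ₚ r ≈ₚ p *ₚ (q *ₚ r)
  *ₚ-assoc []      q r = reflₚ
  *ₚ-assoc (a ∷ p) q r = transₚ (*ₚ-distribʳ r (a · q) (0# ∷ p *ₚ q))
    (+ₚ-cong (·-*ₚ a q r)
      (transₚ (0∷-*ₚ (p *ₚ q) r refl) (∷-cong refl (*ₚ-assoc p q r))))

  *ₚ-identityˡ : ∀ p → 1ₚ *ₚ p ≈ₚ p
  *ₚ-identityˡ p = transₚ (+ₚ-cong (·-identity p) (0∷≈0 refl reflₚ)) (+ₚ-identityʳ p)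

  polynomialRing : CommutativeRing c ℓ
  polynomialRing = record
    { Carrier = Poly
    ; _≈_     = _≈ₚ_
    ; _+_     = _+ₚ_
    ; _*_     = _*ₚ_
    ; -_      = -ₚ_
    ; 0#      = 0ₚ
    ; 1#      = 1ₚ
    ; isCommutativeRing = record
      { isRing = record
        { +-isAbelianGroup = record
          { isGroup = record
            { isMonoid = record
              { isSemigroup = record
                { isMagma = record
                  { isEquivalence = record { refl = reflₚ ; sym = symₚ ; trans = transₚ }
                  ; ∙-cong        = +ₚ-cong
                  }
                ; assoc = +ₚ-assoc
                }
              ; identity = (λ p → reflₚ) , +ₚ-identityʳ
              }
            ; inverse = (λ p → transₚ (+ₚ-comm (-ₚ p) p) (-ₚ-inverseʳ p)) , -ₚ-inverseʳ
            ; ⁻¹-cong = -ₚ-cong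
            }
          ; comm = +ₚ-comm
          }
        ; *-cong     = *ₚ-cong
        ; *-assoc    = *ₚ-assoc
        ; *-identity = *ₚ-identityˡ , λ p → transₚ (*ₚ-comm p 1ₚ) (*ₚ-identityˡ p)
        ; distrib    = *ₚ-distribˡ , *ₚ-distribʳ
        }
      ; *-comm = *ₚ-comm
      }
    }

  _≟0ₚ : ∀ p → Dec (p ≈ₚ 0ₚ)
  [] ≟0ₚ = yes reflₚ
  (a ∷ p) ≟0ₚ with a ≟0 | p ≟0ₚ
  ... | yes e | yes f = yes (0∷≈0 e f)
  ... | no ne | _     = no λ e → ne (coeff≈ e 0)
  ... | _     | no nf = no λ e → nf (coeffwise (coeff≈ e ∘ suc))

  *ₚ-noZeroDivisors : ∀ p q → p *ₚ q ≈ₚ 0ₚ → p ≈ₚ 0ₚ ⊎ q ≈ₚ 0ₚ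
  *ₚ-noZeroDivisors []      q       e = inj₁ reflₚ
  *ₚ-noZeroDivisors (a ∷ p) []      e = inj₂ reflₚ
  *ₚ-noZeroDivisors (a ∷ p) (b ∷ q) e =
    step (*ₚ-noZeroDivisors p (b ∷ q)) (*ₚ-noZeroDivisors (a ∷ p) q)
    where
    step : (p *ₚ (b ∷ q) ≈ₚ 0ₚ → p ≈ₚ 0ₚ ⊎ (b ∷ q) ≈ₚ 0ₚ) →
           ((a ∷ p) *ₚ q ≈ₚ 0ₚ → (a ∷ p) ≈ₚ 0ₚ ⊎ q ≈ₚ 0ₚ) →
           (a ∷ p) ≈ₚ 0ₚ ⊎ (b ∷ q) ≈ₚ 0ₚ
    step recˡ recʳ with a ≟0
    ... | yes a≈0 = Sum.map₁ (0∷≈0 a≈0) (recˡ (coeffwise (coeff≈ shifted ∘ suc)))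
      where
      shifted : (0# ∷ p *ₚ (b ∷ q)) ≈ₚ 0ₚ
      shifted = transₚ (symₚ (0∷-*ₚ p (b ∷ q) a≈0)) e
    ... | no a≉0 = Sum.map₂ (0∷≈0 b≈0) (recʳ (coeffwise (coeff≈ shifted ∘ suc)))
      where
      ab≈0 : a * b ≈ 0#
      ab≈0 = trans (sym (+-identityʳ _)) (coeff≈ e 0)
      b≈0 : b ≈ 0#
      b≈0 = [ (λ a≈0 → ⊥-elim (a≉0 a≈0)) , (λ z → z) ]′ (noZeroDivisors a b ab≈0)
      shifted : (0# ∷ (a ∷ p) *ₚ q) ≈ₚ 0ₚ
      shifted = transₚ (symₚ (transₚ (*ₚ-∷ʳ (a ∷ p) b q)
                  (+ₚ-cong (·-zeroˡ (a ∷ p) b≈0) reflₚ))) e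

  polynomialDomain : DiscreteDomain c ℓ
  polynomialDomain = record
    { commutativeRing = polynomialRing
    ; 1≉0             = λ e → 1≉0 (coeff≈ e 0)
    ; _≟0             = _≟0ₚ
    ; noZeroDivisors  = *ₚ-noZeroDivisors
    }

module FractionLaws {c ℓ} (S : CommutativeSemiring c ℓ) where

  open CommutativeSemiring S
  open import Algebra.Solver.Ring.NaturalCoefficients.Default S

  shuffle : ∀ x y z →
            (x * y) * z ≈
            (x * z) * y
  shuffle = solve 3 (λ x y z →
    (x :* y) :* z :=
    (x :* z) :* y) refl

  expand : ∀ a b c d b′ d′ →
           (a * d + c * b) * (b′ * d′) ≈
           (a * b′) * (d * d′) + (c * d′) * (b * b′)
  expand = solve 6 (λ a b c d b′ d′ →
    (a :* d :+ c :* b) :* (b′ :* d′) :=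
    (a :* b′) :* (d :* d′) :+ (c :* d′) :* (b :* b′)) refl

  collect : ∀ a′ b c′ d b′ d′ →
            (a′ * b) * (d * d′) + (c′ * d) * (b * b′) ≈
            (a′ * d′ + c′ * b′) * (b * d)
  collect = solve 6 (λ a′ b c′ d b′ d′ →
    (a′ :* b) :* (d :* d′) :+ (c′ :* d) :* (b :* b′) :=
    (a′ :* d′ :+ c′ :* b′) :* (b :* d)) refl

  swap : ∀ x y z w →
         (x * y) * (z * w) ≈
         (x * z) * (y * w)
  swap = solve 4 (λ x y z w →
    (x :* y) :* (z :* w) :=
    (x :* z) :* (y :* w)) refl

  +-assoc-law : ∀ a b c d e f →
                ((a * d + c * b) * f + e * (b * d)) * (b * (d * f)) ≈
                (a * (d * f) + (c * f + e * d) * b) * ((b * d) * f)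
  +-assoc-law = solve 6 (λ a b c d e f →
    ((a :* d :+ c :* b) :* f :+ e :* (b :* d)) :* (b :* (d :* f)) :=
    (a :* (d :* f) :+ (c :* f :+ e :* d) :* b) :* ((b :* d) :* f)) refl

  +-comm-law : ∀ a b c d →
               (a * d + c * b) * (d * b) ≈
               (c * b + a * d) * (b * d)
  +-comm-law = solve 4 (λ a b c d →
    (a :* d :+ c :* b) :* (d :* b) :=
    (c :* b :+ a :* d) :* (b :* d)) refl

  +-identity-law : ∀ a b →
                   (0# * b + a * 1#) * b ≈
                   a * (1# * b)
  +-identity-law = solve 2 (λ a b →
    (con 0 :* b :+ a :* con 1) :* b :=
    a :* (con 1 :* b)) refl

  *-assoc-law : ∀ a b c d e f →
                ((a * c) * e) * (b * (d * f)) ≈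
                (a * (c * e)) * ((b * d) * f)
  *-assoc-law = solve 6 (λ a b c d e f →
    ((a :* c) :* e) :* (b :* (d :* f)) :=
    (a :* (c :* e)) :* ((b :* d) :* f)) refl

  *-identity-law : ∀ a b →
                   (1# * a) * b ≈
                   a * (1# * b)
  *-identity-law = solve 2 (λ a b →
    (con 1 :* a) :* b :=
    a :* (con 1 :* b)) refl

  distrib-law : ∀ a b c d e f →
                (a * (c * f + e * d)) * ((b * d) * (b * f)) ≈
                ((a * c) * (b * f) + (a * e) * (b * d)) * (b * (d * f))
  distrib-law = solve 6 (λ a b c d e f →
    (a :* (c :* f :+ e :* d)) :* ((b :* d) :* (b :* f)) :=
    ((a :* c) :* (b :* f) :+ (a :* e) :* (b :* d)) :* (b :* (d :* f))) refl

  *-inverse-law : ∀ a b →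
                  (a * b) * 1# ≈
                  1# * (b * a)
  *-inverse-law = solve 2 (λ a b →
    (a :* b) :* con 1 :=
    con 1 :* (b :* a)) refl

module Fractions {c ℓ} (D : DiscreteDomain c ℓ) where

  open DiscreteDomain D
  open import Relation.Binary.Reasoning.Setoid setoid
  open import Algebra.Properties.Ring ring using (x∙y⁻¹≈ε⇒x≈y; -‿distribˡ-*)

  open FractionLaws commutativeSemiring

  record Fraction : Set (c ⊔ ℓ) where
    constructor fraction
    field
      num   : Carrier
      den   : Carrier
      den≉0 : ¬ (den ≈ 0#)
  open Fraction public

  infix 4 _≈ᶠ_
  record _≈ᶠ_ (a b : Fraction) : Set ℓ where
    constructor cross
    field cross≈ : num a * den b ≈ num b * den a
  open _≈ᶠ_ public

  *-≉0 : ∀ {a b} → ¬ (a ≈ 0#) → ¬ (b ≈ 0#) → ¬ (a * b ≈ 0#)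
  *-≉0 {a} {b} a≉0 b≉0 e = [ a≉0 , b≉0 ]′ (noZeroDivisors a b e)

  *-cancelʳ : ∀ {a b} d → ¬ (d ≈ 0#) → a * d ≈ b * d → a ≈ b
  *-cancelʳ {a} {b} d d≉0 e =
    [ x∙y⁻¹≈ε⇒x≈y a b , (λ d≈0 → ⊥-elim (d≉0 d≈0)) ]′ (noZeroDivisors (a - b) d diff)
    where
    diff : (a - b) * d ≈ 0#
    diff = begin
      (a - b) * d        ≈⟨ trans (distribʳ d a (- b)) (+-congˡ (sym (-‿distribˡ-* b d))) ⟩
      a * d + - (b * d)  ≈⟨ +-congʳ e ⟩
      b * d + - (b * d)  ≈⟨ -‿inverseʳ _ ⟩
      0#                 ∎

  infixl 6 _+ᶠ_
  infixl 7 _*ᶠ_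

  _+ᶠ_ _*ᶠ_ : Fraction → Fraction → Fraction
  fraction a b b≉0 +ᶠ fraction c d d≉0 = fraction (a * d + c * b) (b * d) (*-≉0 b≉0 d≉0)
  fraction a b b≉0 *ᶠ fraction c d d≉0 = fraction (a * c) (b * d) (*-≉0 b≉0 d≉0)

  -ᶠ_ : Fraction → Fraction
  -ᶠ fraction a b b≉0 = fraction (- a) b b≉0

  embed : Carrier → Fraction
  embed a = fraction a 1# 1≉0

  0ᶠ 1ᶠ : Fraction
  0ᶠ = embed 0#
  1ᶠ = embed 1#

  _⁻¹ᶠ : Fraction → Fraction
  fraction a b b≉0 ⁻¹ᶠ with a ≟0
  ... | yes _   = 0ᶠ
  ... | no  a≉0 = fraction b a a≉0

  reflᶠ : ∀ {a} → a ≈ᶠ a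
  reflᶠ = cross refl

  symᶠ : ∀ {a b} → a ≈ᶠ b → b ≈ᶠ a
  symᶠ (cross e) = cross (sym e)

  transᶠ : ∀ {a b c} → a ≈ᶠ b → b ≈ᶠ c → a ≈ᶠ c
  transᶠ {fraction a b _} {fraction c d d≉0} {fraction e f _} (cross p) (cross q) =
    cross (*-cancelʳ d d≉0 (begin
      (a * f) * d  ≈⟨ shuffle a f d ⟩
      (a * d) * f  ≈⟨ *-congʳ p ⟩
      (c * b) * f  ≈⟨ shuffle c b f ⟩
      (c * f) * b  ≈⟨ *-congʳ q ⟩
      (e * d) * b  ≈⟨ shuffle e d b ⟩
      (e * b) * d  ∎))

  +ᶠ-cong : ∀ {a a′ b b′} → a ≈ᶠ a′ → b ≈ᶠ b′ → a +ᶠ b ≈ᶠ a′ +ᶠ b′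
  +ᶠ-cong {fraction a b _} {fraction a′ b′ _} {fraction c d _} {fraction c′ d′ _}
          (cross p) (cross q) = cross (begin
    (a * d + c * b) * (b′ * d′)                ≈⟨ expand a b c d b′ d′ ⟩
    (a * b′) * (d * d′) + (c * d′) * (b * b′)  ≈⟨ +-cong (*-congʳ p) (*-congʳ q) ⟩
    (a′ * b) * (d * d′) + (c′ * d) * (b * b′)  ≈⟨ collect a′ b c′ d b′ d′ ⟩
    (a′ * d′ + c′ * b′) * (b * d)              ∎)

  *ᶠ-cong : ∀ {a a′ b b′} → a ≈ᶠ a′ → b ≈ᶠ b′ → a *ᶠ b ≈ᶠ a′ *ᶠ b′
  *ᶠ-cong {fraction a b _} {fraction a′ b′ _} {fraction c d _} {fraction c′ d′ _}
          (cross p) (cross q) = cross (begin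
    (a * c) * (b′ * d′)    ≈⟨ swap a c b′ d′ ⟩
    (a * b′) * (c * d′)    ≈⟨ *-cong p q ⟩
    (a′ * b) * (c′ * d)    ≈⟨ swap a′ b c′ d ⟩
    (a′ * c′) * (b * d)    ∎)

  -ᶠ-cong : ∀ {a b} → a ≈ᶠ b → -ᶠ a ≈ᶠ -ᶠ b
  -ᶠ-cong {fraction a b _} {fraction c d _} (cross p) = cross (begin
    (- a) * d  ≈⟨ -‿distribˡ-* a d ⟨
    - (a * d)  ≈⟨ -‿cong p ⟩
    - (c * b)  ≈⟨ -‿distribˡ-* c b ⟩
    (- c) * b  ∎)

  +ᶠ-assoc : ∀ a b c → (a +ᶠ b) +ᶠ c ≈ᶠ a +ᶠ (b +ᶠ c)
  +ᶠ-assoc (fraction a b _) (fraction c d _) (fraction e f _) = cross (+-assoc-law a b c d e f)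

  +ᶠ-comm : ∀ a b → a +ᶠ b ≈ᶠ b +ᶠ a
  +ᶠ-comm (fraction a b _) (fraction c d _) = cross (+-comm-law a b c d)

  +ᶠ-identityˡ : ∀ a → 0ᶠ +ᶠ a ≈ᶠ a
  +ᶠ-identityˡ (fraction a b _) = cross (+-identity-law a b)

  -ᶠ-inverseˡ : ∀ a → (-ᶠ a) +ᶠ a ≈ᶠ 0ᶠ
  -ᶠ-inverseˡ (fraction a b _) = cross (begin
    ((- a) * b + a * b) * 1#  ≈⟨ *-identityʳ _ ⟩
    (- a) * b + a * b         ≈⟨ distribʳ b (- a) a ⟨
    (- a + a) * b             ≈⟨ *-congʳ (-‿inverseˡ a) ⟩
    0# * b                    ≈⟨ zeroˡ b ⟩
    0#                        ≈⟨ zeroˡ _ ⟨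
    0# * (b * b)              ∎)

  *ᶠ-assoc : ∀ a b c → (a *ᶠ b) *ᶠ c ≈ᶠ a *ᶠ (b *ᶠ c)
  *ᶠ-assoc (fraction a b _) (fraction c d _) (fraction e f _) = cross (*-assoc-law a b c d e f)

  *ᶠ-comm : ∀ a b → a *ᶠ b ≈ᶠ b *ᶠ a
  *ᶠ-comm (fraction a b _) (fraction c d _) = cross (*-cong (*-comm a c) (*-comm d b))

  *ᶠ-identityˡ : ∀ a → 1ᶠ *ᶠ a ≈ᶠ a
  *ᶠ-identityˡ (fraction a b _) = cross (*-identity-law a b)

  *ᶠ-distribˡ : ∀ a b c → a *ᶠ (b +ᶠ c) ≈ᶠ a *ᶠ b +ᶠ a *ᶠ c
  *ᶠ-distribˡ (fraction a b _) (fraction c d _) (fraction e f _) = cross (distrib-law a b c d e f)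

  *ᶠ-distribʳ : ∀ a b c → (b +ᶠ c) *ᶠ a ≈ᶠ b *ᶠ a +ᶠ c *ᶠ a
  *ᶠ-distribʳ a b c = transᶠ (*ᶠ-comm (b +ᶠ c) a)
    (transᶠ (*ᶠ-distribˡ a b c) (+ᶠ-cong (*ᶠ-comm a b) (*ᶠ-comm a c)))

  fractionRing : CommutativeRing (c ⊔ ℓ) ℓ
  fractionRing = record
    { Carrier = Fraction
    ; _≈_     = _≈ᶠ_
    ; _+_     = _+ᶠ_
    ; _*_     = _*ᶠ_
    ; -_      = -ᶠ_
    ; 0#      = 0ᶠ
    ; 1#      = 1ᶠ
    ; isCommutativeRing = record
      { isRing = record
        { +-isAbelianGroup = record
          { isGroup = record
            { isMonoid = record
              { isSemigroup = record
                { isMagma = record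
                  { isEquivalence = record { refl = reflᶠ ; sym = symᶠ ; trans = transᶠ }
                  ; ∙-cong        = +ᶠ-cong
                  }
                ; assoc = +ᶠ-assoc
                }
              ; identity = +ᶠ-identityˡ , λ a → transᶠ (+ᶠ-comm a 0ᶠ) (+ᶠ-identityˡ a)
              }
            ; inverse = -ᶠ-inverseˡ , λ a → transᶠ (+ᶠ-comm a (-ᶠ a)) (-ᶠ-inverseˡ a)
            ; ⁻¹-cong = -ᶠ-cong
            }
          ; comm = +ᶠ-comm
          }
        ; *-cong     = *ᶠ-cong
        ; *-assoc    = *ᶠ-assoc
        ; *-identity = *ᶠ-identityˡ , λ a → transᶠ (*ᶠ-comm a 1ᶠ) (*ᶠ-identityˡ a)
        ; distrib    = *ᶠ-distribˡ , *ᶠ-distribʳ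
        }
      ; *-comm = *ᶠ-comm
      }
    }

  num≈0⇒≈0ᶠ : ∀ {a} → num a ≈ 0# → a ≈ᶠ 0ᶠ
  num≈0⇒≈0ᶠ e = cross (trans (*-identityʳ _) (trans e (sym (zeroˡ _))))

  ≈0ᶠ⇒num≈0 : ∀ {a} → a ≈ᶠ 0ᶠ → num a ≈ 0#
  ≈0ᶠ⇒num≈0 (cross e) = trans (sym (*-identityʳ _)) (trans e (zeroˡ _))

  _≟0ᶠ : ∀ a → Dec (a ≈ᶠ 0ᶠ)
  a ≟0ᶠ with num a ≟0
  ... | yes e = yes (num≈0⇒≈0ᶠ e)
  ... | no ne = no λ e → ne (≈0ᶠ⇒num≈0 e)

  ⁻¹ᶠ-inverse : ∀ a → ¬ (a ≈ᶠ 0ᶠ) → a *ᶠ a ⁻¹ᶠ ≈ᶠ 1ᶠ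
  ⁻¹ᶠ-inverse (fraction a b _) a≉0ᶠ with a ≟0
  ... | yes e = ⊥-elim (a≉0ᶠ (num≈0⇒≈0ᶠ e))
  ... | no  _ = cross (*-inverse-law a b)

  0ᶠ⁻¹ : ∀ a → a ≈ᶠ 0ᶠ → a ⁻¹ᶠ ≈ᶠ 0ᶠ
  0ᶠ⁻¹ (fraction a b _) e with a ≟0
  ... | yes _ = reflᶠ
  ... | no ne = ⊥-elim (ne (≈0ᶠ⇒num≈0 e))

  fractionField : DiscreteField (c ⊔ ℓ) ℓ
  fractionField = record
    { commutativeRing = fractionRing
    ; 1≉0             = λ e → 1≉0 (≈0ᶠ⇒num≈0 e)
    ; _≟0             = _≟0ᶠ
    ; _⁻¹             = _⁻¹ᶠ
    ; inverse         = ⁻¹ᶠ-inverse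
    ; 0⁻¹             = 0ᶠ⁻¹
    }

ℚ-domain : DiscreteDomain 0ℓ 0ℓ
ℚ-domain = record
  { commutativeRing = ℚ.+-*-commutativeRing
  ; 1≉0             = λ ()
  ; _≟0             = ℚ._≟ ℚ.0ℚ
  ; noZeroDivisors  = noZeroDivisors
  }
  where
  noZeroDivisors : ∀ a b → a ℚ.* b ≡ ℚ.0ℚ → a ≡ ℚ.0ℚ ⊎ b ≡ ℚ.0ℚ
  noZeroDivisors a b ab≡0 with a ℚ.≟ ℚ.0ℚ
  ... | yes a≡0 = inj₁ a≡0
  ... | no  a≢0 = inj₂ (begin
    b                        ≡⟨ ℚ.*-identityˡ b ⟨
    ℚ.1ℚ ℚ.* b               ≡⟨ ≡.cong (ℚ._* b) (ℚ.*-inverseˡ a) ⟨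
    ((ℚ.1/ a) ℚ.* a) ℚ.* b   ≡⟨ ℚ.*-assoc (ℚ.1/ a) a b ⟩
    (ℚ.1/ a) ℚ.* (a ℚ.* b)   ≡⟨ ≡.cong ((ℚ.1/ a) ℚ.*_) ab≡0 ⟩
    (ℚ.1/ a) ℚ.* ℚ.0ℚ        ≡⟨ ℚ.*-zeroʳ (ℚ.1/ a) ⟩
    ℚ.0ℚ                     ∎)
    where
    open ≡.≡-Reasoning
    instance _ = ℚ.≢-nonZero a≢0

module ℚ[x] = Polynomials ℚ-domain
module Fracℚ[x] = Fractions ℚ[x].polynomialDomain

ℚ⟨x⟩ : DiscreteField 0ℓ 0ℓ
ℚ⟨x⟩ = Fracℚ[x].fractionField

x : DiscreteField.Carrier ℚ⟨x⟩
x = Fracℚ[x].embed ℚ[x].X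

Matrix : ∀ {a} → Set a → ℕ → ℕ → Set a
Matrix A m n = Fin m → Fin n → A

module Matrices {c ℓ} (K : DiscreteField c ℓ) where

  open DiscreteField K hiding (zero; inverse)
  open import Algebra.Definitions.RawSemiring (Semiring.rawSemiring semiring) public
    using (sum; _^_) renaming (_×_ to _×ᴷ_)

  infixl 6 _⊕_ _⊖_
  infixl 7 _⊙_

  _⊕_ _⊖_ : ∀ {m n} → Matrix Carrier m n → Matrix Carrier m n → Matrix Carrier m n
  (A ⊕ B) i j = A i j + B i j
  (A ⊖ B) i j = A i j - B i j

  _⊙_ : ∀ {m n} → Carrier → Matrix Carrier m n → Matrix Carrier m n
  (a ⊙ A) i j = a * A i j

  fromℕ : ℕ → Carrier
  fromℕ a = a ×ᴷ 1#

  fromℕᴹ : ∀ {m n} → Matrix ℕ m n → Matrix Carrier m n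
  fromℕᴹ A i j = fromℕ (A i j)

  𝟙 : ∀ {n} → Matrix Carrier n n
  𝟙 i j = if ⌊ i Fin.≟ j ⌋ then 1# else 0#

  -- The n × n block matrix diag(I_k, 0).
  𝟙[_] : ∀ k {n} → Matrix Carrier n n
  𝟙[ k ] i j = if ⌊ toℕ i ℕ.<? k ⌋ then 𝟙 i j else 0#

  minor : ∀ {m n} → Fin (suc m) → Fin (suc n) →
          Matrix Carrier (suc m) (suc n) → Matrix Carrier m n
  minor i j A a b = A (punchIn i a) (punchIn j b)

  sign : ℕ → Carrier
  sign k = (- 1#) ^ k

  det : ∀ {n} → Matrix Carrier n n → Carrier
  det {zero}  A = 1#
  det {suc n} A = sum λ j → sign (toℕ j) * A zero j * det (minor zero j A)

  adjugate : ∀ {n} → Matrix Carrier n n → Matrix Carrier n n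
  adjugate {suc n} A i j = sign (toℕ i ℕ.+ toℕ j) * det (minor j i A)

  -- Meaningful only when det A ≉ 0#.  For a matrix N over ℚ this holds of
  -- A = t I - N whenever t is a non-constant rational function.
  invᴹ : ∀ {n} → Matrix Carrier n n → Matrix Carrier n n
  invᴹ A = (det A) ⁻¹ ⊙ adjugate A

  -- f_N and Γ_N as functions of an arbitrary element t of the field: t = x
  -- gives the characteristic polynomial and the coronal, other values of t
  -- the results of substituting t for x in them.
  charPoly : ∀ {n} → Matrix Carrier n n → Carrier → Carrier
  charPoly N t = det (t ⊙ 𝟙 ⊖ N)

  coronal : ∀ {n} → Matrix Carrier n n → Carrier → Carrier
  coronal N t = sum λ i → sum λ j → invᴹ (t ⊙ 𝟙 ⊖ N) i j

record Graph (n : ℕ) : Set where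
  field
    adj    : Fin n → Fin n → Bool
    symm   : ∀ i j → adj i j ≡ adj j i
    irrefl : ∀ i → adj i i ≡ false
open Graph public

adjacency : ∀ {n} → Graph n → Matrix ℕ n n
adjacency G i j = if adj G i j then 1 else 0

degree : ∀ {n} → Graph n → Fin n → ℕ
degree G i = foldr ℕ._+_ 0 (adjacency G i)

degreeMatrix : ∀ {n} → Graph n → Matrix ℕ n n
degreeMatrix G i j = if ⌊ i Fin.≟ j ⌋ then degree G i else 0

signlessLaplacian : ∀ {n} → Graph n → Matrix ℕ n n
signlessLaplacian G i j = degreeMatrix G i j ℕ.+ adjacency G i j

-- The matrix of A when the vertices are listed as σ 0, σ 1, ….
reorder : ∀ {a} {A : Set a} {n} → Permutation′ n → Matrix A n n → Matrix A n n
reorder σ A i j = A (σ ⟨$⟩ʳ i) (σ ⟨$⟩ʳ j)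

deleteVertex : ∀ {p} → Graph (suc p) → Fin (suc p) → Graph p
deleteVertex H v = record
  { adj    = λ a b → adj H (punchIn v a) (punchIn v b)
  ; symm   = λ a b → symm H (punchIn v a) (punchIn v b)
  ; irrefl = λ a → irrefl H (punchIn v a)
  }

module _ {n k p : ℕ} (F : Graph n) (vs : Fin k → Fin n)
         (H : Graph (suc p)) (v : Fin (suc p)) where

  -- inj₁ a is the vertex a of F, and inj₂ (i , a) the vertex punchIn v a ≢ v
  -- of the i-th copy of H; the vertex v of that copy is inj₁ (vs i).
  pocketAdj : Fin n ⊎ (Fin k × Fin p) → Fin n ⊎ (Fin k × Fin p) → Bool
  pocketAdj (inj₁ a)       (inj₁ b)       = adj F a b
  pocketAdj (inj₁ a)       (inj₂ (j , b)) = ⌊ a Fin.≟ vs j ⌋ ∧ adj H v (punchIn v b)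
  pocketAdj (inj₂ (i , a)) (inj₁ b)       = ⌊ b Fin.≟ vs i ⌋ ∧ adj H v (punchIn v a)
  pocketAdj (inj₂ (i , a)) (inj₂ (j , b)) = ⌊ i Fin.≟ j ⌋ ∧ adj H (punchIn v a) (punchIn v b)

  pocketAdj-symm : ∀ a b → pocketAdj a b ≡ pocketAdj b a
  pocketAdj-symm (inj₁ a)       (inj₁ b)       = symm F a b
  pocketAdj-symm (inj₁ a)       (inj₂ (j , b)) = ≡.refl
  pocketAdj-symm (inj₂ (i , a)) (inj₁ b)       = ≡.refl
  pocketAdj-symm (inj₂ (i , a)) (inj₂ (j , b)) with i Fin.≟ j | j Fin.≟ i
  ... | yes _      | yes _   = symm H (punchIn v a) (punchIn v b)
  ... | no  _      | no  _   = ≡.refl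
  ... | yes ≡.refl | no  i≢i = ⊥-elim (i≢i ≡.refl)
  ... | no  i≢i    | yes ≡.refl = ⊥-elim (i≢i ≡.refl)

  pocketAdj-irrefl : ∀ a → pocketAdj a a ≡ false
  pocketAdj-irrefl (inj₁ a)       = irrefl F a
  pocketAdj-irrefl (inj₂ (i , a)) =
    ≡.trans (≡.cong (⌊ i Fin.≟ i ⌋ ∧_) (irrefl H (punchIn v a))) (∧-zeroʳ ⌊ i Fin.≟ i ⌋)

  pocketVertex : Fin (n ℕ.+ k ℕ.* p) → Fin n ⊎ (Fin k × Fin p)
  pocketVertex u = Sum.map₂ (remQuot p) (splitAt n u)

  pocketGraph : Graph (n ℕ.+ k ℕ.* p)
  pocketGraph = record
    { adj    = λ a b → pocketAdj (pocketVertex a) (pocketVertex b)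
    ; symm   = λ a b → pocketAdj-symm (pocketVertex a) (pocketVertex b)
    ; irrefl = λ a → pocketAdj-irrefl (pocketVertex a)
    }

{-# OPTIONS --safe #-}
module Submission where

-- Write N = (x - 1) I - Q(H₁).  As v is joined to all of H₁, the matrix
-- x I - Q(G) has the blocks x I - Q(F) - (m - 1) D over F (D marking the
-- vertices of V_k), k diagonal copies of N over the pockets, and rows and
-- columns of -1 joining each vᵢ to its pocket.  Eliminating the pockets leaves
-- det N ^ k times the determinant of the Schur complement, in which each vᵢ
-- loses a further 1ᵀ N⁻¹ 1 = Γ(x - 1).  The matrix N is invertible because its
-- determinant is monic in x.

open import Defs
open import Level using (_⊔_) renaming (suc to lsuc)
open import Algebra.Bundles using (Semiring)
open import Data.Bool.Base using (Bool; true; false; _∧_; if_then_else_)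
open import Data.Bool.Properties using (∧-identityʳ)
open import Data.Fin.Base using (Fin; zero; suc; toℕ; fromℕ<; punchIn; punchOut; lift;
  _↑ˡ_; _↑ʳ_; combine; splitAt; remQuot)
open import Data.Fin.Permutation as Perm using (Permutation′; _⟨$⟩ʳ_; _⟨$⟩ˡ_)
import Data.Fin.Properties as Fin
open import Data.Nat.Base as ℕ using (ℕ; zero; suc; _≤_; _<_; z≤n; s≤s)
import Data.Nat.Properties as ℕ
open import Data.Product.Base using (∃; _×_; _,_; proj₁; proj₂)
open import Data.Sum.Base as Sum using (inj₁; inj₂)
open import Data.Unit.Polymorphic.Base using (⊤; tt)
open import Data.Vec.Functional using (_++_; insertAt; removeAt; head; tail)
import Data.Vec.Functional.Properties as Vec
open import Function.Base using (_∘_)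
open import Function.Definitions using (Injective)
open import Relation.Binary.PropositionalEquality as ≡ using (_≡_; _≢_; _≗_)
open import Relation.Nullary using (¬_; yes; no; contradiction)
open import Relation.Nullary.Decidable using (⌊_⌋)

-- The determinant is defined by expansion along the first row only, so row operations, the adjugate
-- identity and invariance under reordering all have to be derived. They are derived for arbitrary
-- alternating multilinear functions of the rows. Columns are reached indirectly: a linear map
-- applied to every row, such as deleting or permuting coordinates, yields another alternating
-- function of the rows, which uniqueness compares with `det`.
--
-- Eliminating by row operations calls for the row vector `1ᵀ N⁻¹`, while the adjugate is shown to
-- be an inverse on the right only and so gives the column `N⁻¹ 1`; the symmetry of `Q(H₁)`
-- identifies the two. As the reciprocal is total with value `0#` at `0#`, none of this has content
-- before `det N` is known to be nonzero. The shift to `x - 1` comes from the single edge that joins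
-- each pocket vertex to its `vᵢ`.

-- Indices of block matrices.

punchIn-↑ˡ : ∀ {m} k (j : Fin (suc m)) (i : Fin m) →
             punchIn (j ↑ˡ k) (i ↑ˡ k) ≡ punchIn j i ↑ˡ k
punchIn-↑ˡ k zero    i       = ≡.refl
punchIn-↑ˡ k (suc j) zero    = ≡.refl
punchIn-↑ˡ k (suc j) (suc i) = ≡.cong suc (punchIn-↑ˡ k j i)

punchIn-↑ʳ : ∀ m {k} (j : Fin (suc m)) (i : Fin k) →
             punchIn (j ↑ˡ k) (m ↑ʳ i) ≡ suc m ↑ʳ i
punchIn-↑ʳ m       zero    i = ≡.refl
punchIn-↑ʳ (suc m) (suc j) i = ≡.cong suc (punchIn-↑ʳ m j i)

++-suc : ∀ {a} {A : Set a} m {k} (T : Fin (suc m) → A) (L : Fin k → A) i →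
         (T ++ L) (suc i) ≡ (tail T ++ L) i
++-suc m T L i with splitAt m i
... | inj₁ _ = ≡.refl
... | inj₂ _ = ≡.refl

take++drop : ∀ {a} {A : Set a} m {k} (W : Fin (m ℕ.+ k) → A) i →
             W i ≡ ((λ j → W (j ↑ˡ k)) ++ (λ j → W (m ↑ʳ j))) i
take++drop zero    W i       = ≡.refl
take++drop (suc m) W zero    = ≡.refl
take++drop (suc m) {k} W (suc i) =
  ≡.trans (take++drop m (tail W) i) (≡.sym (++-suc m (λ j → W (j ↑ˡ k)) _ i))

-- Finite sums and the Kronecker delta over a semiring.

-- ∑ is opaque so that the unifier can read n and f off ∑ f.
module Sums {a ℓ} (S : Semiring a ℓ) where

  open Semiring S hiding (zero)
  open import Algebra.Properties.Semiring.Sum S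

  opaque
    ∑ : ∀ {n} → (Fin n → Carrier) → Carrier
    ∑ = sum

  opaque
    unfolding ∑

    ∑≡sum : ∀ {n} (f : Fin n → Carrier) → ∑ f ≡ sum f
    ∑≡sum f = ≡.refl

    ∑-empty : (f : Fin 0 → Carrier) → ∑ f ≈ 0#
    ∑-empty f = refl

    ∑-suc : ∀ {n} (f : Fin (suc n) → Carrier) → ∑ f ≈ f zero + ∑ (f ∘ suc)
    ∑-suc f = refl

    ∑-cong : ∀ {n} {f g : Fin n → Carrier} → (∀ i → f i ≈ g i) → ∑ f ≈ ∑ g
    ∑-cong = sum-cong-≋

    ∑-+ : ∀ {n} (f g : Fin n → Carrier) → ∑ (λ i → f i + g i) ≈ ∑ f + ∑ g
    ∑-+ = ∑-distrib-+

    ∑-swap : ∀ {m n} (f : Fin m → Fin n → Carrier) →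
             ∑ (λ i → ∑ (λ j → f i j)) ≈ ∑ (λ j → ∑ (λ i → f i j))
    ∑-swap = ∑-comm

    *-∑ : ∀ {n} a (f : Fin n → Carrier) → a * ∑ f ≈ ∑ (λ i → a * f i)
    *-∑ = *-distribˡ-sum

    ∑-* : ∀ {n} a (f : Fin n → Carrier) → ∑ f * a ≈ ∑ (λ i → f i * a)
    ∑-* = *-distribʳ-sum

    ∑-zero : ∀ {n} {f : Fin n → Carrier} → (∀ i → f i ≈ 0#) → ∑ f ≈ 0#
    ∑-zero {n} {f} f≈0 = trans (sum-cong-≋ {n} {f} f≈0) (sum-replicate-zero n)

    ∑-remove : ∀ {n} i (f : Fin (suc n) → Carrier) → ∑ f ≈ f i + ∑ (removeAt f i)
    ∑-remove i f = sum-remove {i = i} f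

    ∑-++ : ∀ m {k} (f : Fin (m ℕ.+ k) → Carrier) →
           ∑ f ≈ ∑ (λ i → f (i ↑ˡ k)) + ∑ (λ i → f (m ↑ʳ i))
    ∑-++ zero    f = sym (+-identityˡ _)
    ∑-++ (suc m) f = trans (+-congˡ (∑-++ m (f ∘ suc))) (sym (+-assoc _ _ _))

    ∑-combine : ∀ k {p} (f : Fin (k ℕ.* p) → Carrier) →
                ∑ f ≈ ∑ (λ i → ∑ (λ j → f (combine {k} i j)))
    ∑-combine zero        f = refl
    ∑-combine (suc k) {p} f =
      trans (∑-++ p f) (+-congˡ (∑-combine k (λ u → f (p ↑ʳ u))))

  -- Unfolds to `𝟙` over the field and to an entry `bit ⌊ i Fin.≟ j ⌋` over ℕ, so the same laws
  -- serve for matrix entries and for counting neighbours.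
  δ : ∀ {n} → Fin n → Fin n → Carrier
  δ i j = if ⌊ i Fin.≟ j ⌋ then 1# else 0#

  δ-≡ : ∀ {n} {i j : Fin n} → i ≡ j → δ i j ≈ 1#
  δ-≡ {i = i} {j} i≡j with i Fin.≟ j
  ... | yes _   = refl
  ... | no  i≢j = contradiction i≡j i≢j

  δ-≢ : ∀ {n} {i j : Fin n} → i ≢ j → δ i j ≈ 0#
  δ-≢ {i = i} {j} i≢j with i Fin.≟ j
  ... | yes i≡j = contradiction i≡j i≢j
  ... | no  _   = refl

  δ-sym : ∀ {n} (i j : Fin n) → δ i j ≈ δ j i
  δ-sym i j with i Fin.≟ j
  ... | yes i≡j = sym (δ-≡ (≡.sym i≡j))
  ... | no  i≢j = sym (δ-≢ (i≢j ∘ ≡.sym))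

  δ-injective : ∀ {m n} {f : Fin m → Fin n} → (∀ {i j} → f i ≡ f j → i ≡ j) →
                ∀ i j → δ (f i) (f j) ≈ δ i j
  δ-injective {f = f} inj i j with i Fin.≟ j
  ... | yes i≡j = δ-≡ (≡.cong f i≡j)
  ... | no  i≢j = δ-≢ (i≢j ∘ inj)

  ∑-δ : ∀ {n} (i : Fin n) (f : Fin n → Carrier) → ∑ (λ j → δ i j * f j) ≈ f i
  ∑-δ zero    f = trans (∑-suc _)
    (trans (+-cong (*-identityˡ _) (∑-zero (λ j → zeroˡ _))) (+-identityʳ _))
  ∑-δ (suc i) f = trans (∑-suc _) (trans (+-cong (zeroˡ _)
    (trans (∑-cong (λ j → *-congʳ (δ-injective Fin.suc-injective i j))) (∑-δ i (f ∘ suc))))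
    (+-identityˡ _))

-- Alternating multilinear functions of the rows.

module Determinants {c ℓ} (K : DiscreteField c ℓ) where

  open DiscreteField K hiding (zero; inverse)
  open import Data.Vec.Functional using (_∷_)
  open Matrices K
  open import Algebra.Properties.Ring ring
    using (-1*x≈-x; -‿involutive; +-inverseˡ-unique)
  open import Algebra.Properties.Semiring.Exp semiring using (^-homo-*)
  open import Algebra.Solver.Ring.NaturalCoefficients.Default commutativeSemiring
    using (solve; _:+_; _:*_; _:=_; con)
  open import Relation.Binary.Reasoning.Setoid setoid
  open Sums semiring public

  infix 4 _≋_

  Row : ℕ → Set c
  Row n = Fin n → Carrier

  _≋_ : ∀ {m n} → Matrix Carrier m n → Matrix Carrier m n → Set ℓ
  A ≋ B = ∀ i j → A i j ≈ B i j

  𝟙-≡ : ∀ {n} {i j : Fin n} → i ≡ j → 𝟙 i j ≈ 1#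
  𝟙-≡ = δ-≡

  𝟙-≢ : ∀ {n} {i j : Fin n} → i ≢ j → 𝟙 i j ≈ 0#
  𝟙-≢ = δ-≢

  𝟙-sym : ∀ {n} (i j : Fin n) → 𝟙 i j ≈ 𝟙 j i
  𝟙-sym = δ-sym

  𝟙-injective : ∀ {m n} {f : Fin m → Fin n} → (∀ {i j} → f i ≡ f j → i ≡ j) →
                ∀ i j → 𝟙 (f i) (f j) ≈ 𝟙 i j
  𝟙-injective = δ-injective

  𝟙-suc : ∀ {n} (i j : Fin n) → 𝟙 (suc i) (suc j) ≈ 𝟙 i j
  𝟙-suc = 𝟙-injective Fin.suc-injective

  ∑-𝟙 : ∀ {n} (i : Fin n) (f : Row n) → ∑ (λ j → 𝟙 i j * f j) ≈ f i
  ∑-𝟙 = ∑-δ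

  ε : Carrier
  ε = - 1#

  ε-cancel : ∀ a → a + ε * a ≈ 0#
  ε-cancel a = trans (+-congˡ (-1*x≈-x a)) (-‿inverseʳ a)

  ε*ε : ε * ε ≈ 1#
  ε*ε = trans (-1*x≈-x ε) (-‿involutive 1#)

  a+b≈0⇒a≈εb : ∀ {a b} → a + b ≈ 0# → a ≈ ε * b
  a+b≈0⇒a≈εb {a} {b} e = trans (+-inverseˡ-unique a b e) (sym (-1*x≈-x b))

  sign*sign : ∀ k → sign k * sign k ≈ 1#
  sign*sign zero    = *-identityˡ 1#
  sign*sign (suc k) = begin
    (ε * sign k) * (ε * sign k)  ≈⟨ solve 2 (λ e s →
                                      (e :* s) :* (e :* s) := (e :* e) :* (s :* s)) refl ε (sign k) ⟩
    (ε * ε) * (sign k * sign k)  ≈⟨ *-cong ε*ε (sign*sign k) ⟩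
    1# * 1#                      ≈⟨ *-identityˡ 1# ⟩
    1#                           ∎

  -- Matrices are functions, and `head A ∷ tail A` agrees with `A` only pointwise, so congruence has
  -- to be one of the axioms of `Alternating`.
  Congruent : ∀ {m n} → (Matrix Carrier m n → Carrier) → Set (c ⊔ ℓ)
  Congruent f = ∀ {A B} → A ≋ B → f A ≈ f B

  VanishesOnRepeat : ∀ {m n} → (Matrix Carrier (suc m) n → Carrier) → Set (c ⊔ ℓ)
  VanishesOnRepeat {zero}  f = ⊤
  VanishesOnRepeat {suc m} f = ∀ v B → f (v ∷ v ∷ B) ≈ 0#

  -- Only equal adjacent rows are required to give 0#, and the axioms for the
  -- rows below the first are those of the function of the remaining rows.
  data Alternating {n} : ∀ {m} → (Matrix Carrier m n → Carrier) → Set (c ⊔ ℓ) where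
    nullary : {f : Matrix Carrier 0 n → Carrier} → Congruent f → Alternating f
    head-linear : ∀ {m} {f : Matrix Carrier (suc m) n → Carrier} →
      Congruent f →
      (∀ v w B → f ((λ j → v j + w j) ∷ B) ≈ f (v ∷ B) + f (w ∷ B)) →
      (∀ a v B → f ((λ j → a * v j) ∷ B) ≈ a * f (v ∷ B)) →
      (∀ v → Alternating (λ B → f (v ∷ B))) →
      VanishesOnRepeat f →
      Alternating f

  ∷-cong : ∀ {m n} {v w : Row n} {A B : Matrix Carrier m n} →
           (∀ j → v j ≈ w j) → A ≋ B → (v ∷ A) ≋ (w ∷ B)
  ∷-cong e e′ zero    = e
  ∷-cong e e′ (suc i) = e′ i

  module _ {n : ℕ} where

    congruent : ∀ {m} {f : Matrix Carrier m n → Carrier} → Alternating f → Congruent f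
    congruent (nullary f-cong)             = f-cong
    congruent (head-linear f-cong _ _ _ _) = f-cong

    module _ {m : ℕ} {f : Matrix Carrier (suc m) n → Carrier} where

      additive : Alternating f → ∀ v w B → f ((λ j → v j + w j) ∷ B) ≈ f (v ∷ B) + f (w ∷ B)
      additive (head-linear _ f-+ _ _ _) = f-+

      homogeneous : Alternating f → ∀ a v B → f ((λ j → a * v j) ∷ B) ≈ a * f (v ∷ B)
      homogeneous (head-linear _ _ f-* _ _) = f-*

      alternating-tail : Alternating f → ∀ v → Alternating (λ B → f (v ∷ B))
      alternating-tail (head-linear _ _ _ f-tail _) = f-tail

      head-cong : Alternating f → ∀ {v w} B → (∀ j → v j ≈ w j) → f (v ∷ B) ≈ f (w ∷ B)
      head-cong f-alt B e = congruent f-alt (∷-cong e (λ i j → refl))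

      tail-cong : Alternating f → ∀ v {A B} → A ≋ B → f (v ∷ A) ≈ f (v ∷ B)
      tail-cong f-alt v e = congruent f-alt (∷-cong (λ j → refl) e)

      head∷tail : Alternating f → ∀ A → f (head A ∷ tail A) ≈ f A
      head∷tail f-alt A = congruent f-alt λ { zero j → refl ; (suc i) j → refl }

      homogeneous-zero : Alternating f → ∀ v B → (∀ j → v j ≈ 0#) → f (v ∷ B) ≈ 0#
      homogeneous-zero f-alt v B v≈0 = begin
        f (v ∷ B)                 ≈⟨ head-cong f-alt B (λ j → trans (v≈0 j) (sym (zeroˡ _))) ⟩
        f ((λ j → 0# * v j) ∷ B)  ≈⟨ homogeneous f-alt 0# v B ⟩
        0# * f (v ∷ B)            ≈⟨ zeroˡ _ ⟩
        0#                        ∎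

      linear : Alternating f → ∀ {k} (a : Row k) (R : Matrix Carrier k n) B →
               f ((λ j → ∑ λ i → a i * R i j) ∷ B) ≈ ∑ λ i → a i * f (R i ∷ B)
      linear f-alt {zero}  a R B = 
        trans (homogeneous-zero f-alt _ B (λ j → ∑-empty _)) (sym (∑-empty _))
      linear f-alt {suc k} a R B = trans (head-cong f-alt B (λ j → ∑-suc _))
        (trans (additive f-alt _ _ B)
          (trans (+-cong (homogeneous f-alt _ _ B) (linear f-alt (tail a) (tail R) B))
            (sym (∑-suc _))))

    repeat-zero : ∀ {m} {f : Matrix Carrier (suc (suc m)) n → Carrier} → Alternating f →
                  ∀ v B → f (v ∷ v ∷ B) ≈ 0#
    repeat-zero (head-linear _ _ _ _ f-rep) = f-rep

    -- Polarization: expand the value at the repeated row `v+w`, which is zero, and drop the two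
    -- terms that repeat `v` or `w`.
    swap-rows : ∀ {m} {f : Matrix Carrier (suc (suc m)) n → Carrier} → Alternating f →
                ∀ v w B → f (v ∷ w ∷ B) ≈ ε * f (w ∷ v ∷ B)
    swap-rows {f = f} f-alt v w B = a+b≈0⇒a≈εb (begin
      f (v ∷ w ∷ B) + f (w ∷ v ∷ B)
        ≈⟨ +-cong (trans (+-congʳ (repeat-zero f-alt v B)) (+-identityˡ _))
                  (trans (+-congˡ (repeat-zero f-alt w B)) (+-identityʳ _)) ⟨
      (f (v ∷ v ∷ B) + f (v ∷ w ∷ B)) + (f (w ∷ v ∷ B) + f (w ∷ w ∷ B))
        ≈⟨ +-cong (additive (alternating-tail f-alt v) v w B)
                  (additive (alternating-tail f-alt w) v w B) ⟨
      f (v ∷ v+w ∷ B) + f (w ∷ v+w ∷ B)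
        ≈⟨ additive f-alt v w (v+w ∷ B) ⟨
      f (v+w ∷ v+w ∷ B)
        ≈⟨ repeat-zero f-alt v+w B ⟩
      0#  ∎)
      where
      v+w : Row n
      v+w j = v j + w j

    -- Swapping `v` with the row below it brings it one place closer to its equal, until the two are
    -- adjacent.
    equal-rows-zero : ∀ {m} {f : Matrix Carrier (suc m) n → Carrier} → Alternating f →
                      ∀ v B i → (∀ j → B i j ≈ v j) → f (v ∷ B) ≈ 0#
    equal-rows-zero {suc m} {f} f-alt v B zero e = begin
      f (v ∷ B)           ≈⟨ congruent f-alt (∷-cong (λ j → refl)
                               λ { zero → e ; (suc i) j → refl }) ⟩
      f (v ∷ v ∷ tail B)  ≈⟨ repeat-zero f-alt v (tail B) ⟩
      0#                  ∎
    equal-rows-zero {suc m} {f} f-alt v B (suc i) e = begin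
      f (v ∷ B)                    ≈⟨ head∷tail (alternating-tail f-alt v) B ⟨
      f (v ∷ head B ∷ tail B)      ≈⟨ swap-rows f-alt v (head B) (tail B) ⟩
      ε * f (head B ∷ v ∷ tail B)  ≈⟨ *-congˡ (equal-rows-zero
                                        (alternating-tail f-alt (head B)) v (tail B) i e) ⟩
      ε * 0#                       ≈⟨ zeroʳ ε ⟩
      0#                           ∎

    -- Row `j` reaches the top by `toℕ j` adjacent swaps, each contributing a factor `ε`.
    rotate-rows : ∀ {m} {f : Matrix Carrier (suc m) n → Carrier} → Alternating f →
                  ∀ A j → f (A j ∷ removeAt A j) ≈ sign (toℕ j) * f A
    rotate-rows f-alt A zero = trans (head∷tail f-alt A) (sym (*-identityˡ _))
    rotate-rows {suc m} {f} f-alt A (suc j) = begin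
      f (A (suc j) ∷ removeAt A (suc j))
        ≈⟨ head∷tail (alternating-tail f-alt (A (suc j))) (removeAt A (suc j)) ⟨
      f (A (suc j) ∷ A zero ∷ removeAt (tail A) j)
        ≈⟨ swap-rows f-alt _ _ _ ⟩
      ε * f (A zero ∷ A (suc j) ∷ removeAt (tail A) j)
        ≈⟨ *-congˡ (rotate-rows (alternating-tail f-alt (A zero)) (tail A) j) ⟩
      ε * (sign (toℕ j) * f (A zero ∷ tail A))
        ≈⟨ *-congˡ (*-congˡ (head∷tail f-alt A)) ⟩
      ε * (sign (toℕ j) * f A)
        ≈⟨ *-assoc ε _ _ ⟨
      (ε * sign (toℕ j)) * f A  ∎

    add-rows-to-head : ∀ {m} {f : Matrix Carrier (suc m) n → Carrier} → Alternating f →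
                       ∀ {k} v (a : Row k) (R : Matrix Carrier k n) B →
                       (∀ i → f (R i ∷ B) ≈ 0#) →
                       f ((λ j → v j + ∑ λ i → a i * R i j) ∷ B) ≈ f (v ∷ B)
    add-rows-to-head {f = f} f-alt v a R B vanish = begin
      f ((λ j → v j + ∑ λ i → a i * R i j) ∷ B)        ≈⟨ additive f-alt _ _ B ⟩
      f (v ∷ B) + f ((λ j → ∑ λ i → a i * R i j) ∷ B)  ≈⟨ +-congˡ (linear f-alt a R B) ⟩
      f (v ∷ B) + ∑ (λ i → a i * f (R i ∷ B))          ≈⟨ +-congˡ (∑-zero λ i →
                                                              trans (*-congˡ (vanish i)) (zeroʳ _)) ⟩
      f (v ∷ B) + 0#                                     ≈⟨ +-identityʳ _ ⟩
      f (v ∷ B)                                          ∎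

    -- The row `v` may lie outside the rows that `f` sees: in `alternating-unique` it is a fixed
    -- first row and `f` is the function of the rows below it. Hence the hypothesis speaks of the
    -- values of `f`, a form that passes to the tail.
    add-multiples : ∀ {m} {f : Matrix Carrier m n → Carrier} → Alternating f → ∀ (v : Row n) →
                    (∀ B i → (∀ j → B i j ≈ v j) → f B ≈ 0#) →
                    ∀ (a : Row m) B → f (λ i j → B i j + a i * v j) ≈ f B
    add-multiples (nullary f-cong) v vanish a B = f-cong λ ()
    add-multiples {suc m} {f} f-alt v vanish a B = begin
      f B′                          ≈⟨ head∷tail f-alt B′ ⟨
      f (head B′ ∷ tail B′)         ≈⟨ add-multiples (alternating-tail f-alt (head B′)) v
                                         (λ C i → vanish (head B′ ∷ C) (suc i)) (tail a) (tail B) ⟩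
      f (head B′ ∷ tail B)          ≈⟨ additive f-alt _ _ (tail B) ⟩
      f (head B ∷ tail B) + f ((λ j → a zero * v j) ∷ tail B)
        ≈⟨ +-cong (head∷tail f-alt B) (trans (homogeneous f-alt _ _ _)
             (trans (*-congˡ (vanish (v ∷ tail B) zero (λ j → refl))) (zeroʳ _))) ⟩
      f B + 0#                      ≈⟨ +-identityʳ _ ⟩
      f B                           ∎
      where
      B′ : Matrix Carrier (suc m) n
      B′ i j = B i j + a i * v j

    alternating-resp : ∀ {m} {f g : Matrix Carrier m n → Carrier} → (∀ A → f A ≈ g A) →
                       Alternating f → Alternating g
    alternating-resp e (nullary f-cong) =
      nullary λ A≋B → trans (sym (e _)) (trans (f-cong A≋B) (e _))
    alternating-resp {g = g} e (head-linear {m} f-cong f-+ f-* f-tail f-rep) = head-linear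
      (λ A≋B → trans (sym (e _)) (trans (f-cong A≋B) (e _)))
      (λ v w B → trans (sym (e _)) (trans (f-+ v w B) (+-cong (e _) (e _))))
      (λ a v B → trans (sym (e _)) (trans (f-* a v B) (*-congˡ (e _))))
      (λ v → alternating-resp (λ B → e (v ∷ B)) (f-tail v))
      (repeat m e f-rep)
      where
      repeat : ∀ m {f g : Matrix Carrier (suc m) n → Carrier} → (∀ A → f A ≈ g A) →
               VanishesOnRepeat f → VanishesOnRepeat g
      repeat zero    e f-rep     = tt
      repeat (suc m) e f-rep v B = trans (sym (e _)) (f-rep v B)

    alternating-combination : ∀ {m k} (a : Row k) (f : Fin k → Matrix Carrier m n → Carrier) →
                              (∀ i → Alternating (f i)) →
                              Alternating (λ B → ∑ λ i → a i * f i B)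
    alternating-combination {zero} a f f-alt =
      nullary λ A≋B → ∑-cong λ i → *-congˡ (congruent (f-alt i) A≋B)
    alternating-combination {suc m} a f f-alt = head-linear
      (λ A≋B → ∑-cong λ i → *-congˡ (congruent (f-alt i) A≋B))
      (λ v w B → trans
        (∑-cong λ i → trans (*-congˡ (additive (f-alt i) v w B)) (distribˡ _ _ _))
        (∑-+ _ _))
      (λ b v B → trans
        (∑-cong λ i → trans (*-congˡ (homogeneous (f-alt i) b v B))
          (solve 3 (λ x y z → x :* (y :* z) := y :* (x :* z)) refl (a i) b (f i (v ∷ B))))
        (sym (*-∑ b _)))
      (λ v → alternating-combination a (λ i B → f i (v ∷ B))
        (λ i → alternating-tail (f-alt i) v))
      (repeat m f f-alt)
      where
      repeat : ∀ m (f : Fin _ → Matrix Carrier (suc m) n → Carrier) →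
               (∀ i → Alternating (f i)) → VanishesOnRepeat (λ B → ∑ λ i → a i * f i B)
      repeat zero    f f-alt     = tt
      repeat (suc m) f f-alt v B =
        ∑-zero λ i → trans (*-congˡ (repeat-zero (f-alt i) v B)) (zeroʳ _)

  record IsLinear {n n′} (L : Row n → Row n′) : Set (c ⊔ ℓ) where
    field
      L-cong : ∀ {v w} → (∀ j → v j ≈ w j) → ∀ j → L v j ≈ L w j
      L-+    : ∀ v w j → L (λ j → v j + w j) j ≈ L v j + L w j
      L-*    : ∀ a v j → L (λ j → a * v j) j ≈ a * L v j

  -- Serves for the maps that delete a coordinate (`det-alternating`), insert a zero
  -- (`alternating-unique`) and permute coordinates (`det-reorder`).
  alternating-map : ∀ {m n n′} {f : Matrix Carrier m n′ → Carrier} {L : Row n → Row n′} →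
                    IsLinear L → Alternating f → Alternating (λ B → f (λ i → L (B i)))
  alternating-map lin (nullary f-cong) = nullary λ A≋B → f-cong λ i → L-cong (A≋B i)
    where open IsLinear lin
  alternating-map {n = n} {n′} {f} {L} lin f-alt@(head-linear {m} f-cong f-+ f-* f-tail f-rep) =
    head-linear
      (λ A≋B → f-cong λ i → L-cong (A≋B i))
      (λ v w B → trans (map-∷ _ B) (trans (head-cong f-alt _ (L-+ v w))
        (trans (f-+ _ _ _) (+-cong (sym (map-∷ v B)) (sym (map-∷ w B))))))
      (λ a v B → trans (map-∷ _ B) (trans (head-cong f-alt _ (L-* a v))
        (trans (f-* _ _ _) (*-congˡ (sym (map-∷ v B))))))
      (λ v → alternating-resp (λ B → sym (map-∷ v B)) (alternating-map lin (f-tail (L v))))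
      (repeat m f-alt)
    where
    open IsLinear lin
    map-∷ : ∀ v B → f (λ i → L ((v ∷ B) i)) ≈ f (L v ∷ λ i → L (B i))
    map-∷ v B = f-cong λ { zero j → refl ; (suc i) j → refl }
    repeat : ∀ m {f : Matrix Carrier (suc m) n′ → Carrier} → Alternating f →
             VanishesOnRepeat (λ B → f (λ i → L (B i)))
    repeat zero    f-alt     = tt
    repeat (suc m) f-alt v B = trans
      (congruent f-alt λ { zero j → refl ; (suc zero) j → refl ; (suc (suc i)) j → refl })
      (repeat-zero f-alt (L v) (λ i → L (B i)))

  -- The determinant, and its uniqueness among alternating functions.

  -- Expanding along two equal rows v: the term of the columns j, punchIn j l
  -- cancels against that of the same two columns in the other order.
  repeated-expansion : ∀ n (v : Row (suc (suc n))) (Δ : (Fin n → Fin (suc (suc n))) → Carrier) →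
    (∀ {g h} → g ≗ h → Δ g ≈ Δ h) →
    (∑ λ j → sign (toℕ j) * v j *
      ∑ λ l → sign (toℕ l) * v (punchIn j l) * Δ (λ i → punchIn j (punchIn l i))) ≈ 0#
  repeated-expansion n v Δ Δ-cong = begin
    ∑ (λ j → s j * v j * inner j)
      ≈⟨ ∑-suc _ ⟩
    1# * v zero * inner zero + ∑ (λ j → ε * s j * w j * inner (suc j))
      ≈⟨ +-cong (*-∑ _ _)
           (trans (∑-cong λ j → trans (*-congˡ (∑-suc _)) (distribˡ _ _ _)) (∑-+ _ _)) ⟩
    ∑ (λ l → 1# * v zero * (s l * w l * Δ (λ i → suc (punchIn l i)))) +
    (∑ (λ j → ε * s j * w j * (1# * v zero * Δ (λ i → suc (punchIn j i)))) +
     ∑ (λ j → ε * s j * w j * rest j))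
      ≈⟨ +-assoc _ _ _ ⟨
    ∑ (λ l → 1# * v zero * (s l * w l * Δ (λ i → suc (punchIn l i)))) +
    ∑ (λ j → ε * s j * w j * (1# * v zero * Δ (λ i → suc (punchIn j i)))) +
    ∑ (λ j → ε * s j * w j * rest j)
      ≈⟨ +-congʳ (∑-+ _ _) ⟨
    ∑ (λ l → 1# * v zero * (s l * w l * Δ (λ i → suc (punchIn l i))) +
             ε * s l * w l * (1# * v zero * Δ (λ i → suc (punchIn l i)))) +
    ∑ (λ j → ε * s j * w j * rest j)
      -- The pairs of columns that contain column zero occur once with it first and once with it
      -- second, and these two terms cancel.
      ≈⟨ +-cong (∑-zero λ l → trans (factor (v zero) (s l) (w l) _) (ε-cancel _))
                (rest-zero n w Δ Δ-cong) ⟩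
    0# + 0#
      ≈⟨ +-identityˡ 0# ⟩
    0#  ∎
    where
    s : ∀ {k} → Fin k → Carrier
    s l = sign (toℕ l)
    w : Row (suc n)
    w j = v (suc j)
    inner : Fin (suc (suc n)) → Carrier
    inner j = ∑ λ l → s l * v (punchIn j l) * Δ (λ i → punchIn j (punchIn l i))
    rest : Fin (suc n) → Carrier
    rest j = ∑ λ l → ε * s l * w (punchIn j l) * Δ (λ i → punchIn (suc j) (punchIn (suc l) i))
    factor : ∀ a s b d → 1# * a * (s * b * d) + ε * s * b * (1# * a * d) ≈
                         a * (s * b * d) + ε * (a * (s * b * d))
    factor a s b d = solve 5 (λ e a s b d →
      con 1 :* a :* (s :* b :* d) :+ e :* s :* b :* (con 1 :* a :* d) :=
      a :* (s :* b :* d) :+ e :* (a :* (s :* b :* d))) refl ε a s b d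
    -- Column zero survives in every term here, so the remaining columns are `lift 1` of those
    -- chosen from the shorter row `w`. The two extra factors `ε` cancel, and what is left is the
    -- original double sum for `w`.
    rest-zero : ∀ n (w : Row (suc n)) (Δ : (Fin n → Fin (suc (suc n))) → Carrier) →
      (∀ {g h} → g ≗ h → Δ g ≈ Δ h) →
      (∑ λ j → ε * s j * w j *
        ∑ λ l → ε * s l * w (punchIn j l) * Δ (λ i → punchIn (suc j) (punchIn (suc l) i))) ≈ 0#
    rest-zero zero    w Δ Δ-cong = ∑-zero λ j → trans (*-congˡ (∑-empty _)) (zeroʳ _)
    rest-zero (suc n) w Δ Δ-cong = trans
      (∑-cong λ j → trans
        (*-congˡ {ε * s j * w j} (trans
          (∑-cong λ l → trans
            (*-congˡ {ε * s l * w (punchIn j l)}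
              (Δ-cong {λ i → punchIn (suc j) (punchIn (suc l) i)}
                      {lift 1 (λ i → punchIn j (punchIn l i))}
                      λ { zero → ≡.refl ; (suc i) → ≡.refl }))
            (pull (s l) (w (punchIn j l)) (Δ (lift 1 (λ i → punchIn j (punchIn l i))))))
          (sym (*-∑ ε _))))
        (cancel (s j) (w j) _))
      (repeated-expansion n w (Δ ∘ lift 1) (λ {g} {h} g≗h →
        Δ-cong {lift 1 g} {lift 1 h} λ { zero → ≡.refl ; (suc i) → ≡.cong suc (g≗h i) }))
      where
      pull : ∀ a b d → ε * a * b * d ≈ ε * (a * b * d)
      pull a b d = trans (*-congʳ (*-assoc _ _ _)) (*-assoc _ _ _)
      cancel : ∀ a b d → ε * a * b * (ε * d) ≈ a * b * d
      cancel a b d = begin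
        ε * a * b * (ε * d)    ≈⟨ solve 4 (λ e a b d →
          e :* a :* b :* (e :* d) := (e :* e) :* (a :* b :* d)) refl ε a b d ⟩
        (ε * ε) * (a * b * d)  ≈⟨ *-congʳ ε*ε ⟩
        1# * (a * b * d)       ≈⟨ *-identityˡ _ ⟩
        a * b * d              ∎

  removeAt-linear : ∀ {n} (j : Fin (suc n)) → IsLinear (λ v → removeAt v j)
  removeAt-linear j = record
    { L-cong = λ e i → e (punchIn j i)
    ; L-+    = λ v w i → refl
    ; L-*    = λ a v i → refl
    }

  det-expand : ∀ {n} (A : Matrix Carrier (suc n) (suc n)) →
               det A ≈ ∑ λ j → sign (toℕ j) * A zero j * det (minor zero j A)
  det-expand A = reflexive (≡.sym (∑≡sum λ j → sign (toℕ j) * A zero j * det (minor zero j A)))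

  det-cong : ∀ {n} → Congruent (det {n})
  det-cong {zero}  e = refl
  det-cong {suc n} {A} {B} e = trans (det-expand A) (trans
    (∑-cong λ j → *-cong (*-congˡ (e zero j)) (det-cong {n} λ a b → e (suc a) (punchIn j b)))
    (sym (det-expand B)))

  -- Linearity in the first row is read off the expansion, and the lower rows enter through a
  -- combination of minors, alternating by induction. Only the vanishing on two equal leading rows
  -- takes a computation.
  det-alternating : ∀ {n} → Alternating (det {n})
  det-alternating {zero}  = nullary (det-cong {zero})
  det-alternating {suc n} = alternating-resp (λ A → sym (det-expand A)) (head-linear
    (λ {A} {B} A≋B → trans (sym (det-expand A)) (trans (det-cong {suc n} A≋B) (det-expand B)))
    (λ v w B → trans
      (∑-cong λ j → trans (*-congʳ (distribˡ _ _ _)) (distribʳ _ _ _))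
      (∑-+ _ _))
    (λ a v B → trans
      (∑-cong λ j → solve 4 (λ s a v d → s :* (a :* v) :* d := a :* (s :* v :* d)) refl
        (sign (toℕ j)) a (v j) (det (λ i l → B i (punchIn j l))))
      (sym (*-∑ a _)))
    (λ v → alternating-combination (λ j → sign (toℕ j) * v j)
      (λ j B → det (λ i → removeAt (B i) j))
      (λ j → alternating-map (removeAt-linear j) det-alternating))
    (repeat n))
    where
    repeat : ∀ n → VanishesOnRepeat
      {n} (λ A → ∑ λ j → sign (toℕ j) * A zero j * det (minor zero j A))
    repeat zero        = tt
    repeat (suc n) v B = trans
      (∑-cong λ j → *-congˡ (det-expand (minor zero j (v ∷ v ∷ B))))
      (repeated-expansion n v (λ g → det (λ i l → B i (g l)))
        (λ g≗h → det-cong {n} λ i l → reflexive (≡.cong (B i) (g≗h l))))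

  insertAt-0-linear : ∀ {n} (k : Fin (suc n)) → IsLinear (λ v → insertAt v k 0#)
  insertAt-0-linear k = record { L-cong = insert-cong k ; L-+ = insert-+ k ; L-* = insert-* k }
    where
    insert-cong : ∀ {n} (k : Fin (suc n)) {v w : Row n} → (∀ j → v j ≈ w j) →
                  ∀ j → insertAt v k 0# j ≈ insertAt w k 0# j
    insert-cong         zero    e zero    = refl
    insert-cong         zero    e (suc j) = e j
    insert-cong {suc n} (suc k) e zero    = e zero
    insert-cong {suc n} (suc k) e (suc j) = insert-cong k (e ∘ suc) j
    insert-+ : ∀ {n} (k : Fin (suc n)) (v w : Row n) j →
               insertAt (λ i → v i + w i) k 0# j ≈ insertAt v k 0# j + insertAt w k 0# j
    insert-+         zero    v w zero    = sym (+-identityˡ 0#)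
    insert-+         zero    v w (suc j) = refl
    insert-+ {suc n} (suc k) v w zero    = refl
    insert-+ {suc n} (suc k) v w (suc j) = insert-+ k (tail v) (tail w) j
    insert-* : ∀ {n} (k : Fin (suc n)) a (v : Row n) j →
               insertAt (λ i → a * v i) k 0# j ≈ a * insertAt v k 0# j
    insert-*         zero    a v zero    = sym (zeroʳ a)
    insert-*         zero    a v (suc j) = refl
    insert-* {suc n} (suc k) a v zero    = refl
    insert-* {suc n} (suc k) a v (suc j) = insert-* k a (tail v) j

  -- Once the unit row `𝟙 k` is among the rows, the second summand can be removed by row operations,
  -- which clears coordinate `k`.
  split-coordinate : ∀ {n} (k : Fin (suc n)) (w : Row (suc n)) j →
                     w j ≈ insertAt (removeAt w k) k 0# j + w k * 𝟙 k j
  split-coordinate zero w zero =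
    sym (trans (+-identityˡ _) (*-identityʳ _))
  split-coordinate zero w (suc j) =
    sym (trans (+-congˡ (zeroʳ _)) (+-identityʳ _))
  split-coordinate {suc n} (suc k) w zero =
    sym (trans (+-congˡ (zeroʳ _)) (+-identityʳ _))
  split-coordinate {suc n} (suc k) w (suc j) =
    trans (split-coordinate k (tail w) j) (+-congˡ (*-congˡ (sym (𝟙-suc k j))))

  -- The first row is a combination of unit rows `𝟙 k`. Below `𝟙 k`, column `k` can be cleared, so
  -- only the minor matters and induction evaluates it; moving `𝟙 k` back into place costs exactly
  -- the sign in the expansion of `det`.
  alternating-unique : ∀ {n} {f : Matrix Carrier n n → Carrier} → Alternating f →
                       ∀ A → f A ≈ det A * f 𝟙
  alternating-unique {zero} f-alt A =
    trans (congruent f-alt {A} {𝟙} λ ()) (sym (*-identityˡ _))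
  alternating-unique {suc n} {f} f-alt A = begin
    f A                                                  ≈⟨ head∷tail f-alt A ⟨
    f (head A ∷ tail A)                                  ≈⟨ head-cong f-alt (tail A) (λ j → expand j) ⟩
    f ((λ j → ∑ λ k → A zero k * 𝟙 k j) ∷ tail A)        ≈⟨ linear f-alt (A zero) 𝟙 (tail A) ⟩
    ∑ (λ k → A zero k * f (𝟙 k ∷ tail A))                ≈⟨ ∑-cong (λ k → trans (*-congˡ (row k))
      (solve 4 (λ a d s x → a :* (d :* (s :* x)) := s :* a :* d :* x) refl
        (A zero k) (det (minor zero k A)) (sign (toℕ k)) (f 𝟙))) ⟩
    ∑ (λ k → sign (toℕ k) * A zero k * det (minor zero k A) * f 𝟙)
                                                         ≈⟨ ∑-* (f 𝟙) _ ⟨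
    ∑ (λ k → sign (toℕ k) * A zero k * det (minor zero k A)) * f 𝟙
                                                         ≈⟨ *-congʳ (det-expand A) ⟨
    det A * f 𝟙                                          ∎
    where
    expand : ∀ j → A zero j ≈ ∑ λ k → A zero k * 𝟙 k j
    expand j = sym (trans
      (∑-cong λ k → trans (*-comm _ _) (*-congʳ (𝟙-sym k j)))
      (∑-𝟙 j (A zero)))
    row : ∀ k → f (𝟙 k ∷ tail A) ≈ det (minor zero k A) * (sign (toℕ k) * f 𝟙)
    row k = begin
      f (𝟙 k ∷ tail A)
        ≈⟨ tail-cong f-alt (𝟙 k) (λ i j → split-coordinate k (A (suc i)) j) ⟩
      f (𝟙 k ∷ λ i j → insertAt (removeAt (A (suc i)) k) k 0# j + A (suc i) k * 𝟙 k j)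
        ≈⟨ add-multiples (alternating-tail f-alt (𝟙 k)) (𝟙 k)
             (λ B i → equal-rows-zero f-alt (𝟙 k) B i) (λ i → A (suc i) k) _ ⟩
      f (𝟙 k ∷ λ i → insertAt (minor zero k A i) k 0#)
        -- Induction is applied to the function of the lower rows, shortened by coordinate `k` and
        -- padded with a zero there.
        ≈⟨ alternating-unique
             (alternating-map (insertAt-0-linear k) (alternating-tail f-alt (𝟙 k)))
             (minor zero k A) ⟩
      det (minor zero k A) * f (𝟙 k ∷ λ i → insertAt (𝟙 i) k 0#)
        ≈⟨ *-congˡ (tail-cong f-alt (𝟙 k) insert-𝟙) ⟩
      det (minor zero k A) * f (𝟙 k ∷ removeAt 𝟙 k)
        ≈⟨ *-congˡ (rotate-rows f-alt 𝟙 k) ⟩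
      det (minor zero k A) * (sign (toℕ k) * f 𝟙)  ∎
      where
      insert-𝟙 : (λ i → insertAt (𝟙 i) k 0#) ≋ removeAt 𝟙 k
      insert-𝟙 i j = sym (begin
        𝟙 (punchIn k i) j
          ≈⟨ split-coordinate k (𝟙 (punchIn k i)) j ⟩
        insertAt (λ l → 𝟙 (punchIn k i) (punchIn k l)) k 0# j + 𝟙 (punchIn k i) k * 𝟙 k j
          ≈⟨ +-cong (IsLinear.L-cong (insertAt-0-linear k)
                       (λ l → 𝟙-injective (Fin.punchIn-injective k _ _) i l) j)
                    (trans (*-congʳ (𝟙-≢ (Fin.punchInᵢ≢i k i))) (zeroˡ _)) ⟩
        insertAt (𝟙 i) k 0# j + 0#
          ≈⟨ +-identityʳ _ ⟩
        insertAt (𝟙 i) k 0# j  ∎)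

  det-𝟙 : ∀ {n} → det (𝟙 {n}) ≈ 1#
  det-𝟙 {zero}  = refl
  det-𝟙 {suc n} = begin
    det (𝟙 {suc n})
      ≈⟨ det-expand (𝟙 {suc n}) ⟩
    ∑ (λ j → sign (toℕ j) * 𝟙 zero j * det (minor zero j (𝟙 {suc n})))
      ≈⟨ ∑-cong (λ j → trans (*-congʳ (*-comm _ _)) (*-assoc _ _ _)) ⟩
    ∑ (λ j → 𝟙 zero j * (sign (toℕ j) * det (minor zero j (𝟙 {suc n}))))
      ≈⟨ ∑-𝟙 zero _ ⟩
    1# * det (minor zero zero (𝟙 {suc n}))
      ≈⟨ *-identityˡ _ ⟩
    det (minor zero zero (𝟙 {suc n}))
      ≈⟨ det-cong {n} 𝟙-suc ⟩
    det (𝟙 {n})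
      ≈⟨ det-𝟙 {n} ⟩
    1#  ∎

  -- Permutations of rows and columns.

  -- The sign of `σ` read off its Lehmer code: each image is counted among the values not yet taken,
  -- as the number of swaps needed to bring that row to the top.
  signature : ∀ {n} → Permutation′ n → Carrier
  signature {zero}  σ = 1#
  signature {suc n} σ = signature (Perm.remove zero σ) * sign (toℕ (σ ⟨$⟩ʳ zero))

  permute-rows : ∀ {m n} {f : Matrix Carrier m n → Carrier} → Alternating f →
                 ∀ σ A → f (λ i → A (σ ⟨$⟩ʳ i)) ≈ signature σ * f A
  permute-rows {zero} f-alt σ A = trans (congruent f-alt {B = A} λ ()) (sym (*-identityˡ _))
  permute-rows {suc m} {f = f} f-alt σ A = begin
    f (λ i → A (σ ⟨$⟩ʳ i))
      ≈⟨ congruent f-alt (λ { zero j → refl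
           ; (suc i) j → reflexive (≡.cong (λ l → A l j) (Perm.punchIn-permute σ zero i)) }) ⟩
    f (A (σ ⟨$⟩ʳ zero) ∷ λ i → removeAt A (σ ⟨$⟩ʳ zero) (σ′ ⟨$⟩ʳ i))
      ≈⟨ permute-rows (alternating-tail f-alt (A (σ ⟨$⟩ʳ zero))) σ′ (removeAt A (σ ⟨$⟩ʳ zero)) ⟩
    signature σ′ * f (A (σ ⟨$⟩ʳ zero) ∷ removeAt A (σ ⟨$⟩ʳ zero))
      ≈⟨ *-congˡ (rotate-rows f-alt A (σ ⟨$⟩ʳ zero)) ⟩
    signature σ′ * (sign (toℕ (σ ⟨$⟩ʳ zero)) * f A)
      ≈⟨ *-assoc _ _ _ ⟨
    signature σ * f A  ∎
    where
    σ′ : Permutation′ m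
    σ′ = Perm.remove zero σ

  𝟙-permutation : ∀ {n} (σ : Permutation′ n) i j → 𝟙 (σ ⟨$⟩ʳ i) (σ ⟨$⟩ʳ j) ≈ 𝟙 i j
  𝟙-permutation σ = 𝟙-injective λ e → ≡.trans (≡.sym (Perm.inverseˡ σ))
    (≡.trans (≡.cong (σ ⟨$⟩ˡ_) e) (Perm.inverseˡ σ))

  -- Permuting rows and columns multiplies every determinant by the same
  -- factor, which is found to be 1# by taking A = 𝟙.
  det-reorder : ∀ {n} (σ : Permutation′ n) A → det (reorder σ A) ≈ det A
  det-reorder {n} σ A = begin
    det (reorder σ A)  ≈⟨ scale A ⟩
    det A * κ          ≈⟨ *-congˡ κ≈1 ⟩
    det A * 1#         ≈⟨ *-identityʳ _ ⟩
    det A              ∎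
    where
    columns : Matrix Carrier n n → Matrix Carrier n n
    columns B i j = B i (σ ⟨$⟩ʳ j)
    κ : Carrier
    κ = signature σ * det (columns 𝟙)
    columns-alternating : Alternating (λ B → det (columns B))
    columns-alternating = alternating-map
      (record { L-cong = λ e j → e (σ ⟨$⟩ʳ j) ; L-+ = λ v w j → refl ; L-* = λ a v j → refl })
      det-alternating
    scale : ∀ B → det (reorder σ B) ≈ det B * κ
    scale B = begin
      det (reorder σ B)                            ≈⟨ permute-rows det-alternating σ (columns B) ⟩
      signature σ * det (columns B)                ≈⟨ *-congˡ (alternating-unique columns-alternating B) ⟩
      signature σ * (det B * det (columns 𝟙))      ≈⟨ solve 3 (λ s b d →
                                                        s :* (b :* d) := b :* (s :* d)) refl _ _ _ ⟩
      det B * κ                                    ∎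
    κ≈1 : κ ≈ 1#
    κ≈1 = begin
      κ                  ≈⟨ *-identityˡ κ ⟨
      1# * κ             ≈⟨ *-congʳ (det-𝟙 {n}) ⟨
      det (𝟙 {n}) * κ    ≈⟨ scale 𝟙 ⟨
      det (reorder σ 𝟙)  ≈⟨ det-cong {n} (𝟙-permutation σ) ⟩
      det (𝟙 {n})        ≈⟨ det-𝟙 {n} ⟩
      1#                 ∎

  -- Row `j` is replaced by row `i` and put on top, where the defining expansion applies. For `i`
  -- equal to `j` the sign of the rotation squares to `1#`; otherwise two rows agree.
  *-adjugate : ∀ {n} (A : Matrix Carrier n n) i j →
               ∑ (λ k → A i k * adjugate A k j) ≈ det A * 𝟙 i j
  *-adjugate {suc n} A i j = begin
    ∑ (λ k → A i k * (sign (toℕ k ℕ.+ toℕ j) * det (minor j k A)))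
      ≈⟨ ∑-cong (λ k → trans (*-congˡ (*-congʳ (^-homo-* ε (toℕ k) (toℕ j))))
           (solve 4 (λ a s t d → a :* (s :* t :* d) := t :* (s :* a :* d)) refl
             (A i k) (sign (toℕ k)) (sign (toℕ j)) (det (minor j k A)))) ⟩
    ∑ (λ k → sign (toℕ j) * (sign (toℕ k) * A i k * det (minor j k A)))
      ≈⟨ *-∑ _ _ ⟨
    sign (toℕ j) * ∑ (λ k → sign (toℕ k) * A i k * det (minor j k A))
      -- `minor j k A` is by computation the minor at row zero and column `k` of
      -- `A i ∷ removeAt A j`.
      ≈⟨ *-congˡ (det-expand (A i ∷ removeAt A j)) ⟨
    sign (toℕ j) * det (A i ∷ removeAt A j)
      ≈⟨ by-row ⟩
    det A * 𝟙 i j  ∎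
    where
    by-row : sign (toℕ j) * det (A i ∷ removeAt A j) ≈ det A * 𝟙 i j
    by-row with j Fin.≟ i
    ... | yes ≡.refl = begin
      sign (toℕ j) * det (A j ∷ removeAt A j)  ≈⟨ *-congˡ (rotate-rows det-alternating A j) ⟩
      sign (toℕ j) * (sign (toℕ j) * det A)    ≈⟨ *-assoc _ _ _ ⟨
      sign (toℕ j) * sign (toℕ j) * det A      ≈⟨ *-congʳ (sign*sign (toℕ j)) ⟩
      1# * det A                               ≈⟨ *-comm _ _ ⟩
      det A * 1#                               ≈⟨ *-congˡ (𝟙-≡ {i = j} ≡.refl) ⟨
      det A * 𝟙 j j                            ∎
    ... | no j≢i = begin
      sign (toℕ j) * det (A i ∷ removeAt A j)
        ≈⟨ *-congˡ (equal-rows-zero det-alternating (A i) (removeAt A j) (punchOut j≢i)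
             (λ l → reflexive (≡.cong (λ r → A r l) (Fin.punchIn-punchOut j≢i)))) ⟩
      sign (toℕ j) * 0#  ≈⟨ zeroʳ _ ⟩
      0#                 ≈⟨ zeroʳ _ ⟨
      det A * 0#         ≈⟨ *-congˡ (𝟙-≢ (j≢i ∘ ≡.sym)) ⟨
      det A * 𝟙 i j      ∎

  -- Determinants of block matrices.

  -- In the first row the right-hand columns contribute zero, and deleting a left-hand column keeps
  -- both the zero block and the lower right block, so induction on `m` applies to each minor.
  det-block-triangular : ∀ m {k} (W : Matrix Carrier (m ℕ.+ k) (m ℕ.+ k)) →
    (∀ i j → W (i ↑ˡ k) (m ↑ʳ j) ≈ 0#) →
    det W ≈ det (λ i j → W (i ↑ˡ k) (j ↑ˡ k)) * det (λ i j → W (m ↑ʳ i) (m ↑ʳ j))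
  det-block-triangular zero        W W≈0 = sym (*-identityˡ _)
  det-block-triangular (suc m) {k} W W≈0 = begin
    det W
      ≈⟨ det-expand W ⟩
    ∑ (λ j → sign (toℕ j) * W zero j * det (minor zero j W))
      ≈⟨ ∑-++ (suc m) _ ⟩
    ∑ (λ j → sign (toℕ (j ↑ˡ k)) * W zero (j ↑ˡ k) * det (minor zero (j ↑ˡ k) W)) +
    ∑ (λ j → sign (toℕ (suc m ↑ʳ j)) * W zero (suc m ↑ʳ j) * det (minor zero (suc m ↑ʳ j) W))
      ≈⟨ +-cong (∑-cong left) (∑-zero λ j →
           trans (*-congʳ (trans (*-congˡ (W≈0 zero j)) (zeroʳ _))) (zeroˡ _)) ⟩
    ∑ (λ j → sign (toℕ j) * W zero (j ↑ˡ k) * det (minor zero j W₁₁) * det W₂₂) + 0#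
      ≈⟨ +-identityʳ _ ⟩
    ∑ (λ j → sign (toℕ j) * W zero (j ↑ˡ k) * det (minor zero j W₁₁) * det W₂₂)
      ≈⟨ ∑-* _ _ ⟨
    ∑ (λ j → sign (toℕ j) * W zero (j ↑ˡ k) * det (minor zero j W₁₁)) * det W₂₂
      ≈⟨ *-congʳ (det-expand W₁₁) ⟨
    det W₁₁ * det W₂₂  ∎
    where
    W₁₁ : Matrix Carrier (suc m) (suc m)
    W₁₁ i j = W (i ↑ˡ k) (j ↑ˡ k)
    W₂₂ : Matrix Carrier k k
    W₂₂ i j = W (suc m ↑ʳ i) (suc m ↑ʳ j)
    left : ∀ j → sign (toℕ (j ↑ˡ k)) * W zero (j ↑ˡ k) * det (minor zero (j ↑ˡ k) W) ≈
                 sign (toℕ j) * W zero (j ↑ˡ k) * det (minor zero j W₁₁) * det W₂₂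
    left j = trans
      (*-cong (*-congʳ (reflexive (≡.cong sign (Fin.toℕ-↑ˡ j k))))
        (trans
          (det-block-triangular m (minor zero (j ↑ˡ k) W) λ i l →
            trans (reflexive (≡.cong (W (suc i ↑ˡ k)) (punchIn-↑ʳ m j l))) (W≈0 (suc i) l))
          (*-cong
            (det-cong {m} λ i l → reflexive (≡.cong (W (suc i ↑ˡ k)) (punchIn-↑ˡ k j l)))
            (det-cong {k} λ i l → reflexive (≡.cong (W (suc m ↑ʳ i)) (punchIn-↑ʳ m j l))))))
      (sym (*-assoc _ _ _))

  add-lower-rows : ∀ m {k n} {f : Matrix Carrier (m ℕ.+ k) n → Carrier} → Alternating f →
    ∀ (T : Matrix Carrier m n) (L : Matrix Carrier k n) (Y : Matrix Carrier m k) →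
    f ((λ i j → T i j + ∑ λ l → Y i l * L l j) ++ L) ≈ f (T ++ L)
  add-lower-rows zero    f-alt T L Y = congruent f-alt λ i j → refl
  add-lower-rows (suc m) {k} {n} {f} f-alt T L Y = begin
    f (T′ ++ L)                   ≈⟨ congruent f-alt (cons T′) ⟩
    f (head T′ ∷ (tail T′ ++ L))  ≈⟨ add-lower-rows m (alternating-tail f-alt (head T′))
                                       (tail T) L (tail Y) ⟩
    f (head T′ ∷ (tail T ++ L))   ≈⟨ add-rows-to-head f-alt (head T) (head Y) L (tail T ++ L)
                                       (λ i → equal-rows-zero f-alt (L i) (tail T ++ L) (m ↑ʳ i)
                                         (λ j → reflexive (≡.cong (λ r → r j)
                                           (Vec.lookup-++ʳ (tail T) L i)))) ⟩
    f (head T ∷ (tail T ++ L))    ≈⟨ congruent f-alt (cons T) ⟨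
    f (T ++ L)                    ∎
    where
    T′ : Matrix Carrier (suc m) n
    T′ i j = T i j + ∑ λ l → Y i l * L l j
    cons : ∀ R → (R ++ L) ≋ (head R ∷ (tail R ++ L))
    cons R zero    j = refl
    cons R (suc i) j = reflexive (≡.cong (λ r → r j) (++-suc m R L i))

  -- `Y` is specified by the equation `B + Y D = 0` between blocks rather than as `- B D⁻¹`, so that
  -- a solution in closed form can be supplied without inverting the large block.
  det-schur : ∀ m {k} (W : Matrix Carrier (m ℕ.+ k) (m ℕ.+ k)) (Y : Matrix Carrier m k) →
    (∀ i j → W (i ↑ˡ k) (m ↑ʳ j) + ∑ (λ l → Y i l * W (m ↑ʳ l) (m ↑ʳ j)) ≈ 0#) →
    det W ≈ det (λ i j → W (i ↑ˡ k) (j ↑ˡ k) + ∑ λ l → Y i l * W (m ↑ʳ l) (j ↑ˡ k)) *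
            det (λ i j → W (m ↑ʳ i) (m ↑ʳ j))
  det-schur m {k} W Y W≈0 = begin
    det W
      ≈⟨ det-cong {m ℕ.+ k} (λ i j → reflexive (≡.cong (λ r → r j) (take++drop m W i))) ⟩
    det (T ++ L)
      ≈⟨ add-lower-rows m det-alternating T L Y ⟨
    det (T′ ++ L)
      ≈⟨ det-block-triangular m (T′ ++ L) (λ i j → trans (upper i (m ↑ʳ j)) (W≈0 i j)) ⟩
    det (λ i j → (T′ ++ L) (i ↑ˡ k) (j ↑ˡ k)) * det (λ i j → (T′ ++ L) (m ↑ʳ i) (m ↑ʳ j))
      ≈⟨ *-cong (det-cong {m} λ i j → upper i (j ↑ˡ k))
                (det-cong {k} λ i j → reflexive (≡.cong (λ r → r (m ↑ʳ j)) (Vec.lookup-++ʳ T′ L i))) ⟩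
    det (λ i j → T′ i (j ↑ˡ k)) * det (λ i j → L i (m ↑ʳ j))  ∎
    where
    T T′ : Matrix Carrier m (m ℕ.+ k)
    L    : Matrix Carrier k (m ℕ.+ k)
    T i = W (i ↑ˡ k)
    L i = W (m ↑ʳ i)
    T′ i j = T i j + ∑ λ l → Y i l * L l j
    upper : ∀ i j → (T′ ++ L) (i ↑ˡ k) j ≈ T′ i j
    upper i j = reflexive (≡.cong (λ r → r j) (Vec.lookup-++ˡ T′ L i))

  det-block-diagonal : ∀ k {p} (N : Matrix Carrier p p) (D : Matrix Carrier (k ℕ.* p) (k ℕ.* p)) →
    (∀ i a j b → D (combine {k} i a) (combine {k} j b) ≈ 𝟙 i j * N a b) → det D ≈ det N ^ k
  det-block-diagonal zero        N D D≈ = refl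
  det-block-diagonal (suc k) {p} N D D≈ = begin
    det D
      ≈⟨ det-block-triangular p D corner ⟩
    det (λ a b → D (a ↑ˡ (k ℕ.* p)) (b ↑ˡ (k ℕ.* p))) * det (λ u w → D (p ↑ʳ u) (p ↑ʳ w))
      ≈⟨ *-cong (det-cong {p} λ a b → trans (D≈ zero a zero b) (*-identityˡ _))
                (det-block-diagonal k N _ λ i a j b →
                  trans (D≈ (suc i) a (suc j) b) (*-congʳ (𝟙-suc i j))) ⟩
    det N * det N ^ k  ∎
    where
    corner : ∀ a u → D (a ↑ˡ (k ℕ.* p)) (p ↑ʳ u) ≈ 0#
    corner a u with Fin.combine-surjective {k} {p} u
    ... | j , b , ≡.refl = trans (D≈ zero a (suc j) b) (zeroˡ _)

-- Degrees in `t` and monic determinants.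

-- Below d a stands for "a is a polynomial in t of degree < d".
record DegreeFiltration {c ℓ} (K : DiscreteField c ℓ) (t : DiscreteField.Carrier K) :
                        Set (lsuc (c ⊔ ℓ)) where
  open DiscreteField K hiding (zero; inverse)
  open Matrices K using (_^_)
  field
    Below      : ℕ → Carrier → Set (c ⊔ ℓ)
    Below-resp : ∀ {d a b} → a ≈ b → Below d a → Below d b
    Below-0    : ∀ {d} → Below d 0#
    Below-1    : Below 1 1#
    Below--1   : Below 1 (- 1#)
    Below-t    : Below 2 t
    Below-suc  : ∀ {d a} → Below d a → Below (suc d) a
    Below-+    : ∀ {d a b} → Below d a → Below d b → Below d (a + b)
    -- Degree at most `d` times degree below `e`: the asymmetric form avoids the truncated
    -- subtraction in `d + e - 1`.
    Below-*    : ∀ {d e a b} → Below (suc d) a → Below e b → Below (d ℕ.+ e) (a * b)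
    -- The transcendence of `t`. The other axioms would all hold for a `Below` that is always true.
    t^-sharp   : ∀ d → ¬ Below d (t ^ d)

module MonicDeterminants {c ℓ} {K : DiscreteField c ℓ} {t : DiscreteField.Carrier K}
                         (filtration : DegreeFiltration K t) where

  open DiscreteField K hiding (zero; inverse)
  open DegreeFiltration filtration
  open Matrices K
  open Determinants K
  open import Algebra.Properties.Ring ring using (-1*x≈-x)
  open import Algebra.Solver.Ring.NaturalCoefficients.Default commutativeSemiring
    using (solve; _:+_; _:*_; _:=_; con)
  open import Relation.Binary.Reasoning.Setoid setoid

  Below-∑ : ∀ {d n} (f : Row n) → (∀ i → Below d (f i)) → Below d (∑ f)
  Below-∑ {n = zero}  f f< = Below-resp (sym (∑-empty f)) Below-0
  Below-∑ {n = suc n} f f< =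
    Below-resp (sym (∑-suc f)) (Below-+ (f< zero) (Below-∑ (f ∘ suc) (f< ∘ suc)))

  Below-sign : ∀ k → Below 1 (sign k)
  Below-sign zero    = Below-1
  Below-sign (suc k) = Below-* Below--1 (Below-sign k)

  Below-fromℕ : ∀ k → Below 1 (fromℕ k)
  Below-fromℕ zero    = Below-0
  Below-fromℕ (suc k) = Below-+ Below-1 (Below-fromℕ k)

  Below-neg : ∀ {d a} → Below d a → Below d (- a)
  Below-neg a< = Below-resp (-1*x≈-x _) (Below-* Below--1 a<)

  Below-det : ∀ {n} (A : Matrix Carrier n n) → (∀ i j → Below 2 (A i j)) → Below (suc n) (det A)
  Below-det {zero}  A A< = Below-1
  Below-det {suc n} A A< = Below-resp (sym (det-expand A)) (Below-∑ _ λ j →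
    Below-* (Below-* (Below-sign (toℕ j)) (A< zero j))
            (Below-det (minor zero j A) λ i l → A< (suc i) (punchIn j l)))

  -- A column free of `t` saves one degree: either the expansion picks its constant entry or the
  -- minor still contains that column. In `det-monic` the minors away from the pivot have such a
  -- first column, made of off-diagonal entries.
  Below-det-constantColumn : ∀ {n} (A : Matrix Carrier (suc n) (suc n)) →
    (∀ i j → Below 2 (A i j)) → (∀ i → Below 1 (A i zero)) → Below (suc n) (det A)
  Below-det-constantColumn {n} A A< A₀< =
    Below-resp (sym (det-expand A)) (Below-∑ _ (term n A A< A₀<))
    where
    term : ∀ n (A : Matrix Carrier (suc n) (suc n)) →
           (∀ i j → Below 2 (A i j)) → (∀ i → Below 1 (A i zero)) →
           ∀ j → Below (suc n) (sign (toℕ j) * A zero j * det (minor zero j A))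
    term n A A< A₀< zero =
      Below-* (Below-* (Below-sign 0) (A₀< zero))
              (Below-det (minor zero zero A) λ i l → A< (suc i) (suc l))
    term (suc n) A A< A₀< (suc j) =
      Below-* (Below-* (Below-sign (toℕ (suc j))) (A< zero (suc j)))
              (Below-det-constantColumn (minor zero (suc j) A)
                (λ i l → A< (suc i) (punchIn (suc j) l)) (λ i → A₀< (suc i)))

  Monic : ℕ → Carrier → Set (c ⊔ ℓ)
  Monic d a = ∃ λ b → Below d b × a ≈ t ^ d + b

  -- If `t ^ d + b` were zero, `t ^ d` would equal `- b`, of degree below `d`, against `t^-sharp`.
  monic⇒≉0 : ∀ {d a} → Monic d a → ¬ (a ≈ 0#)
  monic⇒≉0 {d} {a} (b , b< , a≈) a≈0 = t^-sharp d (Below-resp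
    (trans (-1*x≈-x b) (sym (trans (a+b≈0⇒a≈εb (trans (sym a≈) a≈0)) (-1*x≈-x b))))
    (Below-* Below--1 b<))

  -- Only the pivot term reaches full degree: in every other term the factor from row zero is
  -- constant and the minor has a constant first column.
  det-monic : ∀ {n} (A : Matrix Carrier n n) → (∀ i → Monic 1 (A i i)) →
              (∀ {i j} → i ≢ j → Below 1 (A i j)) → Monic n (det A)
  det-monic {zero}  A diag off = 0# , Below-0 , sym (+-identityʳ _)
  det-monic {suc n} A diag off
    with diag zero
       | det-monic (minor zero zero A) (diag ∘ suc) (λ i≢j → off (i≢j ∘ Fin.suc-injective))
  ... | e , e< , A₀₀≈ | b , b< , det≈ =
    t * b + (e * d₀ + rest) ,
    Below-+ (Below-* Below-t b<)
      (Below-+ (Below-* e< (Below-det (minor zero zero A) λ i j → linear-entry (suc i) (suc j)))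
               (Below-∑ _ λ j → Below-suc (term n A linear-entry off j))) ,
    (begin
      det A
        ≈⟨ trans (det-expand A) (∑-suc _) ⟩
      1# * A zero zero * d₀ + rest
        ≈⟨ +-congʳ (*-congʳ (trans (*-identityˡ _) A₀₀≈)) ⟩
      (t * 1# + e) * d₀ + rest
        ≈⟨ solve 4 (λ t e d r →
             (t :* con 1 :+ e) :* d :+ r := t :* d :+ (e :* d :+ r)) refl t e d₀ rest ⟩
      t * d₀ + (e * d₀ + rest)
        ≈⟨ +-congʳ (trans (*-congˡ det≈) (distribˡ _ _ _)) ⟩
      t * t ^ n + t * b + (e * d₀ + rest)
        ≈⟨ +-assoc _ _ _ ⟩
      t * t ^ n + (t * b + (e * d₀ + rest))  ∎)
    where
    d₀ rest : Carrier
    d₀ = det (minor zero zero A)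
    rest = ∑ λ j → sign (toℕ (suc j)) * A zero (suc j) * det (minor zero (suc j) A)
    linear-entry : ∀ i j → Below 2 (A i j)
    linear-entry i j with i Fin.≟ j
    ... | no i≢j     = Below-suc (off i≢j)
    ... | yes ≡.refl with diag i
    ... | e , e< , Aᵢᵢ≈ = Below-resp (sym Aᵢᵢ≈)
      (Below-+ (Below-resp (sym (*-identityʳ t)) Below-t) (Below-suc e<))
    term : ∀ n (A : Matrix Carrier (suc n) (suc n)) → (∀ i j → Below 2 (A i j)) →
           (∀ {i j} → i ≢ j → Below 1 (A i j)) →
           ∀ j → Below n (sign (toℕ (suc j)) * A zero (suc j) * det (minor zero (suc j) A))
    term (suc n) A A< off j =
      Below-* (Below-* (Below-sign (toℕ (suc j))) (off λ ()))
        (Below-det-constantColumn (minor zero (suc j) A)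
          (λ i l → A< (suc i) (punchIn (suc j) l)) (λ i → off λ ()))

  charPoly-shift≉0 : ∀ {n} (Q : Matrix ℕ n n) → ¬ (charPoly (fromℕᴹ Q) (t - 1#) ≈ 0#)
  charPoly-shift≉0 Q = monic⇒≉0 (det-monic _ diag off)
    where
    diag : ∀ i → Monic 1 ((t - 1#) * 𝟙 i i - fromℕ (Q i i))
    diag i = - 1# + - fromℕ (Q i i) , Below-+ Below--1 (Below-neg (Below-fromℕ (Q i i))) , (begin
      (t - 1#) * 𝟙 i i - fromℕ (Q i i)      ≈⟨ +-congʳ (trans (*-congˡ (𝟙-≡ {i = i} ≡.refl))
                                                              (*-identityʳ _)) ⟩
      t - 1# - fromℕ (Q i i)                ≈⟨ +-assoc _ _ _ ⟩
      -- `t * 1#` is what `t ^ 1` computes to, as `Monic 1` requires.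
      t + (- 1# + - fromℕ (Q i i))          ≈⟨ +-congʳ (*-identityʳ t) ⟨
      t * 1# + (- 1# + - fromℕ (Q i i))     ∎)
    off : ∀ {i j} → i ≢ j → Below 1 ((t - 1#) * 𝟙 i j - fromℕ (Q i j))
    off {i} {j} i≢j = Below-resp
      (sym (trans (+-congʳ (trans (*-congˡ (𝟙-≢ i≢j)) (zeroʳ _))) (+-identityˡ _)))
      (Below-neg (Below-fromℕ (Q i j)))

-- The degree filtration on fractions of polynomials.

module FractionEmbedding {c ℓ} (D : DiscreteDomain c ℓ) where

  open DiscreteDomain D
  open Fractions D
  open import Algebra.Solver.Ring.NaturalCoefficients.Default commutativeSemiring
    using (solve; _:+_; _:*_; _:=_; con)

  embed-injective : ∀ {a b} → embed a ≈ᶠ embed b → a ≈ b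
  embed-injective (cross e) = trans (sym (*-identityʳ _)) (trans e (*-identityʳ _))

  embed-+ : ∀ a b → embed (a + b) ≈ᶠ embed a +ᶠ embed b
  embed-+ a b = cross (solve 2 (λ a b →
    (a :+ b) :* (con 1 :* con 1) := (a :* con 1 :+ b :* con 1) :* con 1) refl a b)

  embed-* : ∀ a b → embed (a * b) ≈ᶠ embed a *ᶠ embed b
  embed-* a b = cross (solve 2 (λ a b →
    (a :* b) :* (con 1 :* con 1) := (a :* b) :* con 1) refl a b)

module PolynomialFractions {c ℓ} (D : DiscreteDomain c ℓ) where

  open DiscreteDomain D
  open Polynomials D
  open import Data.List.Base using ([]; _∷_)
  open Fractions polynomialDomain
    using (Fraction; _≈ᶠ_; embed; reflᶠ; symᶠ; transᶠ; +ᶠ-cong; *ᶠ-cong; fractionField)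
  open FractionEmbedding polynomialDomain
  open Matrices fractionField using () renaming (_^_ to _^ᶠ_)

  -- Degree is bounded through coefficients because trailing zeros make the length of the list no
  -- invariant of the polynomial.
  VanishesFrom : ℕ → Poly → Set ℓ
  VanishesFrom d p = ∀ {m} → d ≤ m → coeff p m ≈ 0#

  coeff-*-suc : ∀ a p q m → coeff ((a ∷ p) *ₚ q) (suc m) ≈ a * coeff q (suc m) + coeff (p *ₚ q) m
  coeff-*-suc a p q m = trans (coeff-+ (a · q) (0# ∷ p *ₚ q) (suc m)) (+-congʳ (coeff-· a q (suc m)))

  vanishesFrom-* : ∀ d e p q → VanishesFrom (suc d) p → VanishesFrom e q →
                   VanishesFrom (d ℕ.+ e) (p *ₚ q)
  vanishesFrom-* d e [] q p< q< d+e≤m = refl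
  -- The bound forces `p` to vanish, which leaves the scalar multiple `a · q`.
  vanishesFrom-* zero e (a ∷ p) q p< q< {m} e≤m = trans (coeff-+ (a · q) (0# ∷ p *ₚ q) m)
    (trans (+-cong (trans (coeff-· a q m) (trans (*-congˡ (q< e≤m)) (zeroʳ a)))
                   (coeff≈ (0∷≈0 refl (*ₚ-cong {q = q} p≈0 reflₚ)) m))
           (+-identityˡ 0#))
    where
    p≈0 : p ≈ₚ 0ₚ
    p≈0 = coeffwise λ n → p< (s≤s z≤n)
  vanishesFrom-* (suc d) e (a ∷ p) q p< q< {suc m} (s≤s d+e≤m) = trans (coeff-*-suc a p q m)
    (trans (+-cong (trans (*-congˡ (q< (ℕ.m≤n⇒m≤1+n (ℕ.≤-trans (ℕ.m≤n+m e d) d+e≤m)))) (zeroʳ a))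
                   (vanishesFrom-* d e p q (λ d<m → p< (s≤s d<m)) q< d+e≤m))
           (+-identityˡ 0#))

  infixr 8 _^ₚ_
  _^ₚ_ : Poly → ℕ → Poly
  p ^ₚ zero  = 1ₚ
  p ^ₚ suc d = p *ₚ p ^ₚ d

  embed-^ : ∀ p d → embed (p ^ₚ d) ≈ᶠ embed p ^ᶠ d
  embed-^ p zero    = reflᶠ
  embed-^ p (suc d) = transᶠ (embed-* p (p ^ₚ d)) (*ᶠ-cong (reflᶠ {embed p}) (embed-^ p d))

  coeff-X^ : ∀ d → coeff (X ^ₚ d) d ≈ 1#
  coeff-X^ zero    = refl
  coeff-X^ (suc d) = trans (coeff≈ (0∷-*ₚ {0#} 1ₚ (X ^ₚ d) refl) (suc d))
    (trans (coeff≈ (*ₚ-identityˡ (X ^ₚ d)) d) (coeff-X^ d))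

  Below : ℕ → Fraction → Set (c ⊔ ℓ)
  Below d a = ∃ λ p → a ≈ᶠ embed p × VanishesFrom d p

  filtration : DegreeFiltration fractionField (embed X)
  filtration = record
    { Below      = Below
    ; Below-resp = λ { a≈b (p , a≈p , p<) → p , transᶠ (symᶠ a≈b) a≈p , p< }
    ; Below-0    = 0ₚ , reflᶠ , λ _ → refl
    ; Below-1    = 1ₚ , reflᶠ , λ { (s≤s _) → refl }
    ; Below--1   = -ₚ 1ₚ , reflᶠ , λ { (s≤s _) → refl }
    ; Below-t    = X , reflᶠ , λ { (s≤s (s≤s _)) → refl }
    ; Below-suc  = λ { (p , a≈p , p<) → p , a≈p , λ d<m → p< (ℕ.<⇒≤ d<m) }
    ; Below-+    = λ { {a = a} {b} (p , a≈p , p<) (q , b≈q , q<) →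
        p +ₚ q , transᶠ (+ᶠ-cong a≈p b≈q) (symᶠ (embed-+ p q)) , λ {m} d≤m →
        trans (coeff-+ p q m) (trans (+-cong (p< d≤m) (q< d≤m)) (+-identityˡ 0#)) }
    ; Below-*    = λ { {d} {e} {a} {b} (p , a≈p , p<) (q , b≈q , q<) →
        p *ₚ q , transᶠ (*ᶠ-cong a≈p b≈q) (symᶠ (embed-* p q)) , vanishesFrom-* d e p q p< q< }
    -- Injectivity of `embed` moves the equation to polynomials, where the coefficient at `d` is
    -- `1#` on one side and `0#` on the other.
    ; t^-sharp   = λ { d (p , x^d≈p , p<) → 1≉0 (trans (sym (coeff-X^ d))
        (trans (coeff≈ (embed-injective (transᶠ (embed-^ X d) x^d≈p)) d) (p< ℕ.≤-refl))) }
    }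

-- Pigeonhole: punching out a missed value would inject `Fin (suc n)` into `Fin n`.
injective⇒surjective : ∀ {n} {f : Fin n → Fin n} → Injective _≡_ _≡_ f → ∀ j → ∃ λ i → f i ≡ j
injective⇒surjective {suc n} {f} f-inj j with Fin.any? (λ i → f i Fin.≟ j)
... | yes found = found
... | no  none  = contradiction (Fin.injective⇒≤ {f = λ i → punchOut (j≢f i)}
                    (λ {i} {i′} e → f-inj (Fin.punchOut-injective (j≢f i) (j≢f i′) e))) ℕ.1+n≰n
  where
  j≢f : ∀ i → j ≢ f i
  j≢f i j≡fi = none (i , ≡.sym j≡fi)

↑ˡ≢↑ʳ : ∀ {m n} (i : Fin m) (j : Fin n) → i ↑ˡ n ≢ m ↑ʳ j
↑ˡ≢↑ʳ {m} {n} i j e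
  with ≡.trans (≡.sym (Fin.splitAt-↑ˡ m i n))
               (≡.trans (≡.cong (splitAt m) e) (Fin.splitAt-↑ʳ m n j))
... | ()

-- Degrees and the signless Laplacian of a graph with pockets.

module GraphCounting where

  open Sums ℕ.+-*-semiring
  open ≡.≡-Reasoning

  bit : Bool → ℕ
  bit b = if b then 1 else 0

  bit-∧ : ∀ b c → bit (b ∧ c) ≡ bit b ℕ.* bit c
  bit-∧ true  c = ≡.sym (ℕ.+-identityʳ (bit c))
  bit-∧ false c = ≡.refl

  ∑-bit≤ : ∀ {n} (b : Fin n → Bool) → ∑ (bit ∘ b) ≤ n
  ∑-bit≤ {zero}  b = ℕ.≤-reflexive (∑-empty _)
  ∑-bit≤ {suc n} b = ℕ.≤-trans (ℕ.≤-reflexive (∑-suc _)) (ℕ.+-mono-≤ (bit≤1 (b zero)) (∑-bit≤ (b ∘ suc)))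
    where
    bit≤1 : ∀ c → bit c ≤ 1
    bit≤1 true  = s≤s z≤n
    bit≤1 false = z≤n

  -- One false entry would leave the other entries with a sum exceeding their number.
  ∑-bit-full : ∀ {n} (b : Fin n → Bool) → ∑ (bit ∘ b) ≡ n → ∀ i → b i ≡ true
  ∑-bit-full {suc n} b full with b zero in b₀ | ≡.trans (≡.sym (∑-suc (bit ∘ b))) full
  ... | false | e =
    contradiction (≡.subst (_≤ n) e (∑-bit≤ (b ∘ suc))) ℕ.1+n≰n
  ... | true  | e =
    λ { zero → b₀ ; (suc i) → ∑-bit-full (b ∘ suc) (ℕ.suc-injective e) i }

  ∑-const : ∀ n a → ∑ {n} (λ _ → a) ≡ n ℕ.* a
  ∑-const zero    a = ∑-empty _
  ∑-const (suc n) a = ≡.trans (∑-suc _) (≡.cong (a ℕ.+_) (∑-const n a))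

  degree-∑ : ∀ {n} (G : Graph n) i → degree G i ≡ ∑ (λ j → bit (adj G i j))
  degree-∑ G i = ≡.sym (∑≡sum (adjacency G i))

  full-degree : ∀ {p} (H : Graph (suc p)) v → degree H v ≡ p → ∀ b → adj H v (punchIn v b) ≡ true
  full-degree {p} H v deg≡p = ∑-bit-full (λ b → adj H v (punchIn v b)) (begin
    ∑ (λ b → bit (adj H v (punchIn v b)))
      ≡⟨ ≡.cong (λ c → bit c ℕ.+ ∑ (λ b → bit (adj H v (punchIn v b)))) (irrefl H v) ⟨
    bit (adj H v v) ℕ.+ ∑ (λ b → bit (adj H v (punchIn v b)))
      ≡⟨ ∑-remove v (λ b → bit (adj H v b)) ⟨
    ∑ (λ b → bit (adj H v b))
      ≡⟨ degree-∑ H v ⟨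
    degree H v
      ≡⟨ deg≡p ⟩
    p  ∎)

  signlessLaplacian-δ : ∀ {n} (G : Graph n) i j →
                        signlessLaplacian G i j ≡ δ i j ℕ.* degree G i ℕ.+ bit (adj G i j)
  signlessLaplacian-δ G i j with i Fin.≟ j
  ... | yes _ = ≡.cong (ℕ._+ bit (adj G i j)) (≡.sym (ℕ.+-identityʳ _))
  ... | no  _ = ≡.refl

  module Pockets {n k p : ℕ} (F : Graph n) (vs : Fin k → Fin n) (H : Graph (suc p)) (v : Fin (suc p))
                 (v-dominating : ∀ b → adj H v (punchIn v b) ≡ true) where

    G : Graph (n ℕ.+ k ℕ.* p)
    G = pocketGraph F vs H v

    H₁ : Graph p
    H₁ = deleteVertex H v

    base : Fin n → Fin (n ℕ.+ k ℕ.* p)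
    base a = a ↑ˡ (k ℕ.* p)

    pocket : Fin k → Fin p → Fin (n ℕ.+ k ℕ.* p)
    pocket i a = n ↑ʳ combine i a

    pocketVertex-base : ∀ a → pocketVertex F vs H v (base a) ≡ inj₁ a
    pocketVertex-base a = ≡.cong (Sum.map₂ (remQuot p)) (Fin.splitAt-↑ˡ n a (k ℕ.* p))

    pocketVertex-pocket : ∀ i a → pocketVertex F vs H v (pocket i a) ≡ inj₂ (i , a)
    pocketVertex-pocket i a = ≡.trans
      (≡.cong (Sum.map₂ (remQuot p)) (Fin.splitAt-↑ʳ n (k ℕ.* p) (combine i a)))
      (≡.cong inj₂ (Fin.remQuot-combine i a))

    adj-base-base : ∀ a b → adj G (base a) (base b) ≡ adj F a b
    adj-base-base a b = ≡.cong₂ (pocketAdj F vs H v) (pocketVertex-base a) (pocketVertex-base b)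

    adj-base-pocket : ∀ a j b → adj G (base a) (pocket j b) ≡ ⌊ a Fin.≟ vs j ⌋
    adj-base-pocket a j b = ≡.trans
      (≡.cong₂ (pocketAdj F vs H v) (pocketVertex-base a) (pocketVertex-pocket j b))
      (≡.trans (≡.cong (⌊ a Fin.≟ vs j ⌋ ∧_) (v-dominating b)) (∧-identityʳ _))

    adj-pocket-base : ∀ i a b → adj G (pocket i a) (base b) ≡ ⌊ b Fin.≟ vs i ⌋
    adj-pocket-base i a b = ≡.trans (symm G (pocket i a) (base b)) (adj-base-pocket b i a)

    adj-pocket-pocket : ∀ i a j b →
      adj G (pocket i a) (pocket j b) ≡ ⌊ i Fin.≟ j ⌋ ∧ adj H₁ a b
    adj-pocket-pocket i a j b =
      ≡.cong₂ (pocketAdj F vs H v) (pocketVertex-pocket i a) (pocketVertex-pocket j b)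

    ∑-vertices : ∀ f → ∑ f ≡ ∑ (λ a → f (base a)) ℕ.+ ∑ (λ i → ∑ (λ b → f (pocket i b)))
    ∑-vertices f = ≡.trans (∑-++ n f) (≡.cong (∑ (λ a → f (base a)) ℕ.+_) (∑-combine k _))

    -- The multiplicity of `a` in `vs`. Counting with it defers the injectivity of `vs` to
    -- `pocketCount-σ`, where it becomes the indicator of the marked vertices.
    pocketCount : Fin n → ℕ
    pocketCount a = ∑ λ i → δ a (vs i)

    degree-base : ∀ a → degree G (base a) ≡ degree F a ℕ.+ p ℕ.* pocketCount a
    degree-base a = begin
      degree G (base a)
        ≡⟨ ≡.trans (degree-∑ G (base a)) (∑-vertices _) ⟩
      ∑ (λ b → bit (adj G (base a) (base b))) ℕ.+
      ∑ (λ i → ∑ (λ b → bit (adj G (base a) (pocket i b))))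
        ≡⟨ ≡.cong₂ ℕ._+_
             (∑-cong λ b → ≡.cong bit (adj-base-base a b))
             (∑-cong λ i → ≡.trans (∑-cong λ b → ≡.cong bit (adj-base-pocket a i b)) (∑-const p _)) ⟩
      ∑ (λ b → bit (adj F a b)) ℕ.+ ∑ (λ i → p ℕ.* δ a (vs i))
        ≡⟨ ≡.cong₂ ℕ._+_ (degree-∑ F a) (*-∑ p _) ⟨
      degree F a ℕ.+ p ℕ.* pocketCount a  ∎

    -- The extra one is the edge to `vs i`; it adds an identity matrix to `Q(H₁)` and so turns `t`
    -- into `t - 1#` in the diagonal blocks.
    degree-pocket : ∀ i a → degree G (pocket i a) ≡ suc (degree H₁ a)
    degree-pocket i a = begin
      degree G (pocket i a)
        ≡⟨ ≡.trans (degree-∑ G (pocket i a)) (∑-vertices _) ⟩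
      ∑ (λ b → bit (adj G (pocket i a) (base b))) ℕ.+
      ∑ (λ j → ∑ (λ b → bit (adj G (pocket i a) (pocket j b))))
        ≡⟨ ≡.cong₂ ℕ._+_ (∑-cong toBase) (∑-cong toPocket) ⟩
      ∑ (λ b → δ (vs i) b ℕ.* 1) ℕ.+ ∑ (λ j → δ i j ℕ.* degree H₁ a)
        ≡⟨ ≡.cong₂ ℕ._+_ (∑-δ (vs i) (λ _ → 1)) (∑-δ i (λ _ → degree H₁ a)) ⟩
      suc (degree H₁ a)  ∎
      where
      toBase : ∀ b → bit (adj G (pocket i a) (base b)) ≡ δ (vs i) b ℕ.* 1
      toBase b = begin
        bit (adj G (pocket i a) (base b))  ≡⟨ ≡.cong bit (adj-pocket-base i a b) ⟩
        δ b (vs i)                         ≡⟨ δ-sym b (vs i) ⟩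
        δ (vs i) b                         ≡⟨ ℕ.*-identityʳ _ ⟨
        δ (vs i) b ℕ.* 1                   ∎
      toPocket : ∀ j → ∑ (λ b → bit (adj G (pocket i a) (pocket j b))) ≡ δ i j ℕ.* degree H₁ a
      toPocket j = begin
        ∑ (λ b → bit (adj G (pocket i a) (pocket j b)))
          ≡⟨ ∑-cong (λ b → ≡.trans (≡.cong bit (adj-pocket-pocket i a j b)) (bit-∧ ⌊ i Fin.≟ j ⌋ _)) ⟩
        ∑ (λ b → δ i j ℕ.* bit (adj H₁ a b))
          ≡⟨ *-∑ (δ i j) _ ⟨
        δ i j ℕ.* ∑ (λ b → bit (adj H₁ a b))
          ≡⟨ ≡.cong (δ i j ℕ.*_) (degree-∑ H₁ a) ⟨
        δ i j ℕ.* degree H₁ a  ∎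

    pocket-injectiveˡ : ∀ {i a j b} → pocket i a ≡ pocket j b → i ≡ j
    pocket-injectiveˡ {i} {a} {j} {b} e = Fin.combine-injectiveˡ i a j b (Fin.↑ʳ-injective n _ _ e)

    pocket-injectiveʳ : ∀ {i a j b} → pocket i a ≡ pocket j b → a ≡ b
    pocket-injectiveʳ {i} {a} {j} {b} e = Fin.combine-injectiveʳ i a j b (Fin.↑ʳ-injective n _ _ e)

    δ-pocket : ∀ i a j b → δ (pocket i a) (pocket j b) ≡ δ i j ℕ.* δ a b
    δ-pocket i a j b with i Fin.≟ j | a Fin.≟ b
    ... | yes ≡.refl | yes ≡.refl = δ-≡ {i = pocket i a} ≡.refl
    ... | yes _      | no  a≢b    = δ-≢ (a≢b ∘ pocket-injectiveʳ {i} {a} {j} {b})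
    ... | no  i≢j    | _          = δ-≢ (i≢j ∘ pocket-injectiveˡ {i} {a} {j} {b})

    Q-base-base : ∀ a b → signlessLaplacian G (base a) (base b) ≡
                  signlessLaplacian F a b ℕ.+ p ℕ.* (pocketCount a ℕ.* δ a b)
    Q-base-base a b = begin
      signlessLaplacian G (base a) (base b)
        ≡⟨ signlessLaplacian-δ G (base a) (base b) ⟩
      δ (base a) (base b) ℕ.* degree G (base a) ℕ.+ bit (adj G (base a) (base b))
        ≡⟨ ≡.cong₂ ℕ._+_
             (≡.cong₂ ℕ._*_ (δ-injective (Fin.↑ˡ-injective _ _ _) a b) (degree-base a))
             (≡.cong bit (adj-base-base a b)) ⟩
      δ a b ℕ.* (degree F a ℕ.+ p ℕ.* pocketCount a) ℕ.+ bit (adj F a b)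
        ≡⟨ solve 5 (λ e d p s c → e :* (d :+ p :* s) :+ c := e :* d :+ c :+ p :* (s :* e)) ≡.refl
             (δ a b) (degree F a) p (pocketCount a) (bit (adj F a b)) ⟩
      δ a b ℕ.* degree F a ℕ.+ bit (adj F a b) ℕ.+ p ℕ.* (pocketCount a ℕ.* δ a b)
        ≡⟨ ≡.cong (ℕ._+ p ℕ.* (pocketCount a ℕ.* δ a b)) (signlessLaplacian-δ F a b) ⟨
      signlessLaplacian F a b ℕ.+ p ℕ.* (pocketCount a ℕ.* δ a b)  ∎
      where open import Data.Nat.Solver using (module +-*-Solver)
            open +-*-Solver

    Q-base-pocket : ∀ a j b → signlessLaplacian G (base a) (pocket j b) ≡ δ a (vs j)
    Q-base-pocket a j b = ≡.trans (signlessLaplacian-δ G (base a) (pocket j b))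
      (≡.cong₂ ℕ._+_ (≡.cong (ℕ._* degree G (base a)) (δ-≢ (↑ˡ≢↑ʳ a (combine j b))))
                     (≡.cong bit (adj-base-pocket a j b)))

    Q-pocket-base : ∀ i a b → signlessLaplacian G (pocket i a) (base b) ≡ δ b (vs i)
    Q-pocket-base i a b = ≡.trans (signlessLaplacian-δ G (pocket i a) (base b))
      (≡.cong₂ ℕ._+_ (≡.cong (ℕ._* degree G (pocket i a)) (δ-≢ (↑ˡ≢↑ʳ b (combine i a) ∘ ≡.sym)))
                     (≡.cong bit (adj-pocket-base i a b)))

    Q-pocket-pocket : ∀ i a j b → signlessLaplacian G (pocket i a) (pocket j b) ≡
                      δ i j ℕ.* (δ a b ℕ.+ signlessLaplacian H₁ a b)
    Q-pocket-pocket i a j b = begin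
      signlessLaplacian G (pocket i a) (pocket j b)
        ≡⟨ signlessLaplacian-δ G (pocket i a) (pocket j b) ⟩
      δ (pocket i a) (pocket j b) ℕ.* degree G (pocket i a) ℕ.+ bit (adj G (pocket i a) (pocket j b))
        ≡⟨ ≡.cong₂ ℕ._+_ (≡.cong₂ ℕ._*_ (δ-pocket i a j b) (degree-pocket i a))
             (≡.trans (≡.cong bit (adj-pocket-pocket i a j b)) (bit-∧ ⌊ i Fin.≟ j ⌋ _)) ⟩
      δ i j ℕ.* δ a b ℕ.* suc (degree H₁ a) ℕ.+ δ i j ℕ.* bit (adj H₁ a b)
        ≡⟨ solve 4 (λ e f d c → e :* f :* (con 1 :+ d) :+ e :* c := e :* (f :+ (f :* d :+ c))) ≡.refl
             (δ i j) (δ a b) (degree H₁ a) (bit (adj H₁ a b)) ⟩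
      δ i j ℕ.* (δ a b ℕ.+ (δ a b ℕ.* degree H₁ a ℕ.+ bit (adj H₁ a b)))
        ≡⟨ ≡.cong (λ q → δ i j ℕ.* (δ a b ℕ.+ q)) (signlessLaplacian-δ H₁ a b) ⟨
      δ i j ℕ.* (δ a b ℕ.+ signlessLaplacian H₁ a b)  ∎
      where
      open import Data.Nat.Solver using (module +-*-Solver)
      open +-*-Solver

    pocketCount-vs : Injective _≡_ _≡_ vs → ∀ l → pocketCount (vs l) ≡ 1
    pocketCount-vs vs-inj l = begin
      ∑ (λ i → δ (vs l) (vs i))  ≡⟨ ∑-cong (λ i → ≡.trans (δ-injective vs-inj l i)
                                                        (≡.sym (ℕ.*-identityʳ _))) ⟩
      ∑ (λ i → δ l i ℕ.* 1)      ≡⟨ ∑-δ l (λ _ → 1) ⟩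
      1                          ∎

    position-reflects : ∀ {a b : Fin n} (a<k : toℕ a ℕ.< k) (b<k : toℕ b ℕ.< k) →
                        fromℕ< a<k ≡ fromℕ< b<k → a ≡ b
    position-reflects a<k b<k e = Fin.toℕ-injective (Fin.fromℕ<-injective _ _ a<k b<k e)

    -- The positions of the vertices `vs i` are `k` distinct numbers below `k`, so by pigeonhole
    -- they exhaust the first `k` places.
    pocketCount-σ : Injective _≡_ _≡_ vs → (σ : Permutation′ n) → (∀ i → toℕ (σ ⟨$⟩ˡ vs i) ℕ.< k) →
                    ∀ a → pocketCount (σ ⟨$⟩ʳ a) ≡ bit ⌊ toℕ a ℕ.<? k ⌋
    pocketCount-σ vs-inj σ σ<k a with toℕ a ℕ.<? k
    ... | no a≮k = ∑-zero λ i → δ-≢ λ σa≡vsi → a≮k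
      (≡.subst (λ b → toℕ b ℕ.< k) (≡.trans (≡.cong (σ ⟨$⟩ˡ_) (≡.sym σa≡vsi)) (Perm.inverseˡ σ)) (σ<k i))
    ... | yes a<k with injective⇒surjective {f = position} position-injective (fromℕ< a<k)
      where
      position : Fin k → Fin k
      position i = fromℕ< (σ<k i)
      position-injective : Injective _≡_ _≡_ position
      position-injective {i} {j} e = vs-inj (begin
        vs i                   ≡⟨ Perm.inverseʳ σ ⟨
        σ ⟨$⟩ʳ (σ ⟨$⟩ˡ vs i)   ≡⟨ ≡.cong (σ ⟨$⟩ʳ_) (position-reflects (σ<k i) (σ<k j) e) ⟩
        σ ⟨$⟩ʳ (σ ⟨$⟩ˡ vs j)   ≡⟨ Perm.inverseʳ σ ⟩
        vs j                   ∎)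
    ... | l , e = begin
      pocketCount (σ ⟨$⟩ʳ a)                ≡⟨ ≡.cong (λ b → pocketCount (σ ⟨$⟩ʳ b))
                                                     (position-reflects (σ<k l) a<k e) ⟨
      pocketCount (σ ⟨$⟩ʳ (σ ⟨$⟩ˡ vs l))    ≡⟨ ≡.cong pocketCount (Perm.inverseʳ σ) ⟩
      pocketCount (vs l)                    ≡⟨ pocketCount-vs vs-inj l ⟩
      1                                     ∎

-- Row sums of the inverse of a symmetric matrix.

module SymmetricInverse {c ℓ} (K : DiscreteField c ℓ) where

  open DiscreteField K hiding (zero)
  open Matrices K
  open Determinants K
  open import Algebra.Solver.Ring.NaturalCoefficients.Default commutativeSemiring
    using (solve; _:*_; _:=_)
  open import Relation.Binary.Reasoning.Setoid setoid

  module _ {p : ℕ} (N : Matrix Carrier p p) (N-sym : ∀ a b → N a b ≈ N b a)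
           (det≉0 : ¬ (det N ≈ 0#)) where

    inverseRowSum : Row p
    inverseRowSum a = ∑ (invᴹ N a)

    -- The row sums of the inverse solve N u = 1; by symmetry also uᵀ N = 1ᵀ.
    inverseRowSum-* : ∀ b → ∑ (λ a → inverseRowSum a * N a b) ≈ 1#
    inverseRowSum-* b = begin
      ∑ (λ a → inverseRowSum a * N a b)
        ≈⟨ ∑-cong (λ a → trans (*-comm _ _) (trans (*-congʳ (N-sym a b)) (*-∑ _ _))) ⟩
      ∑ (λ a → ∑ (λ c → N b a * (det N ⁻¹ * adjugate N a c)))
        ≈⟨ ∑-swap _ ⟩
      ∑ (λ c → ∑ (λ a → N b a * (det N ⁻¹ * adjugate N a c)))
        ≈⟨ ∑-cong (λ c → trans (∑-cong (λ a →
             solve 3 (λ x y z → x :* (y :* z) := y :* (x :* z)) refl (N b a) (det N ⁻¹) (adjugate N a c)))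
             (sym (*-∑ _ _))) ⟩
      ∑ (λ c → det N ⁻¹ * ∑ (λ a → N b a * adjugate N a c))
        ≈⟨ ∑-cong (λ c → trans (*-congˡ (*-adjugate N b c))
             (solve 3 (λ x y z → x :* (y :* z) := z :* (y :* x)) refl (det N ⁻¹) (det N) (𝟙 b c))) ⟩
      ∑ (λ c → 𝟙 b c * (det N * det N ⁻¹))
        ≈⟨ ∑-𝟙 b _ ⟩
      det N * det N ⁻¹
        ≈⟨ inverse (det N) det≉0 ⟩
      1#  ∎

-- Eliminating the pockets, over any field at any `t` for which `N` is invertible.

module PocketCharPoly {c ℓ} (K : DiscreteField c ℓ) (t : DiscreteField.Carrier K) where

  open DiscreteField K hiding (zero)
  open Matrices K
  open Determinants K
  open SymmetricInverse K
  open import Algebra.Properties.Ring ring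
    using (-‿distribˡ-*; -‿distribʳ-*; -1*x≈-x; -‿+-comm)
  open import Algebra.Properties.Semiring.Mult semiring using (×-homo-+; ×1-homo-*)
  open import Algebra.Solver.Ring.NaturalCoefficients.Default commutativeSemiring
    using (solve; _:*_; _:=_)
  open import Relation.Binary.Reasoning.Setoid setoid
  open GraphCounting using (bit; full-degree; module Pockets)
  module ∑ℕ = Sums ℕ.+-*-semiring

  fromℕ-+ : ∀ a b → fromℕ (a ℕ.+ b) ≈ fromℕ a + fromℕ b
  fromℕ-+ = ×-homo-+ 1#

  fromℕ-* : ∀ a b → fromℕ (a ℕ.* b) ≈ fromℕ a * fromℕ b
  fromℕ-* = ×1-homo-*

  fromℕ-bit : ∀ b → fromℕ (bit b) ≈ (if b then 1# else 0#)
  fromℕ-bit true  = +-identityʳ 1#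
  fromℕ-bit false = refl

  fromℕ-δ : ∀ {n} (i j : Fin n) → fromℕ (∑ℕ.δ i j) ≈ 𝟙 i j
  fromℕ-δ i j = fromℕ-bit ⌊ i Fin.≟ j ⌋

  fromℕ-∑ : ∀ {n} (f : Fin n → ℕ) → fromℕ (∑ℕ.∑ f) ≈ ∑ (λ i → fromℕ (f i))
  fromℕ-∑ {zero}  f = trans (reflexive (≡.cong fromℕ (∑ℕ.∑-empty f))) (sym (∑-empty _))
  fromℕ-∑ {suc n} f = trans (reflexive (≡.cong fromℕ (∑ℕ.∑-suc f)))
    (trans (fromℕ-+ (f zero) _) (trans (+-congˡ (fromℕ-∑ (f ∘ suc))) (sym (∑-suc _))))

  coronal-∑ : ∀ {p} (Q : Matrix Carrier p p) s → coronal Q s ≈ ∑ λ i → ∑ (invᴹ (s ⊙ 𝟙 ⊖ Q) i)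
  coronal-∑ Q s = trans
    (reflexive (≡.sym (∑≡sum λ i → sum (invᴹ (s ⊙ 𝟙 ⊖ Q) i))))
    (∑-cong λ i → reflexive (≡.sym (∑≡sum (invᴹ (s ⊙ 𝟙 ⊖ Q) i))))

  -- Both sides are the indicator of `a`, `b` and `j` coinciding; this is why the correction due to
  -- the pockets is diagonal.
  𝟙-*-𝟙 : ∀ {n} (a b j : Fin n) → 𝟙 a j * 𝟙 b j ≈ 𝟙 a j * 𝟙 a b
  𝟙-*-𝟙 a b j with a Fin.≟ j
  ... | yes ≡.refl = *-congˡ (𝟙-sym b a)
  ... | no  _      = trans (zeroˡ _) (sym (zeroˡ _))

  signlessLaplacian-symm : ∀ {n} (G : Graph n) i j → signlessLaplacian G i j ≡ signlessLaplacian G j i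
  signlessLaplacian-symm G i j with i Fin.≟ j | j Fin.≟ i
  ... | yes ≡.refl | yes _   = ≡.refl
  ... | yes i≡j    | no  j≢i = contradiction (≡.sym i≡j) j≢i
  ... | no  i≢j    | yes j≡i = contradiction (≡.sym j≡i) i≢j
  ... | no  _      | no  _   = ≡.cong bit (symm G i j)

  module _ {n k p : ℕ} (F : Graph n) (vs : Fin k → Fin n) (vs-injective : Injective _≡_ _≡_ vs)
           (H : Graph (suc p)) (v : Fin (suc p)) (degree≡p : degree H v ≡ p)
           (det≉0 : ¬ (charPoly (fromℕᴹ (signlessLaplacian (deleteVertex H v))) (t - 1#) ≈ 0#)) where

    open Pockets F vs H v (full-degree H v degree≡p)

    QF : Matrix Carrier n n
    QF = fromℕᴹ (signlessLaplacian F)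

    QG W : Matrix Carrier (n ℕ.+ k ℕ.* p) (n ℕ.+ k ℕ.* p)
    QG = fromℕᴹ (signlessLaplacian G)
    W  = t ⊙ 𝟙 ⊖ QG

    QH₁ N : Matrix Carrier p p
    QH₁ = fromℕᴹ (signlessLaplacian H₁)
    N   = (t - 1#) ⊙ 𝟙 ⊖ QH₁

    N-sym : ∀ a b → N a b ≈ N b a
    N-sym a b = +-cong (*-congˡ (𝟙-sym a b))
      (-‿cong (reflexive (≡.cong fromℕ (signlessLaplacian-symm H₁ a b))))

    u : Row p
    u = inverseRowSum N N-sym det≉0

    Γ : Carrier
    Γ = coronal QH₁ (t - 1#)

    count : Fin n → Carrier
    count a = fromℕ (pocketCount a)

    count-∑ : ∀ a → count a ≈ ∑ λ i → 𝟙 a (vs i)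
    count-∑ a = trans (fromℕ-∑ _) (∑-cong λ i → fromℕ-δ a (vs i))

    ∑-pockets : ∀ a b → ∑ (λ i → 𝟙 a (vs i) * 𝟙 b (vs i)) ≈ count a * 𝟙 a b
    ∑-pockets a b = begin
      ∑ (λ i → 𝟙 a (vs i) * 𝟙 b (vs i))  ≈⟨ ∑-cong (λ i → 𝟙-*-𝟙 a b (vs i)) ⟩
      ∑ (λ i → 𝟙 a (vs i) * 𝟙 a b)       ≈⟨ ∑-* (𝟙 a b) _ ⟨
      ∑ (λ i → 𝟙 a (vs i)) * 𝟙 a b       ≈⟨ *-congʳ (count-∑ a) ⟨
      count a * 𝟙 a b                    ∎

    W-base-base : ∀ a b → W (base a) (base b) ≈
                  t * 𝟙 a b - (QF a b + fromℕ p * (count a * 𝟙 a b))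
    W-base-base a b = +-cong
      (*-congˡ (𝟙-injective (Fin.↑ˡ-injective _ _ _) a b))
      (-‿cong (begin
        QG (base a) (base b)
          ≈⟨ reflexive (≡.cong fromℕ (Q-base-base a b)) ⟩
        fromℕ (signlessLaplacian F a b ℕ.+ p ℕ.* (pocketCount a ℕ.* ∑ℕ.δ a b))
          ≈⟨ trans (fromℕ-+ (signlessLaplacian F a b) _)
                   (+-congˡ (fromℕ-* p (pocketCount a ℕ.* ∑ℕ.δ a b))) ⟩
        QF a b + fromℕ p * fromℕ (pocketCount a ℕ.* ∑ℕ.δ a b)
          ≈⟨ +-congˡ (*-congˡ (trans (fromℕ-* (pocketCount a) _) (*-congˡ (fromℕ-δ a b)))) ⟩
        QF a b + fromℕ p * (count a * 𝟙 a b)  ∎))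

    off-diagonal : ∀ {i j a b} → i ≢ j → signlessLaplacian G i j ≡ ∑ℕ.δ {n} a b → W i j ≈ - 𝟙 a b
    off-diagonal {a = a} {b} i≢j Q≡δ = trans
      (+-cong (trans (*-congˡ (𝟙-≢ i≢j)) (zeroʳ t))
              (-‿cong (trans (reflexive (≡.cong fromℕ Q≡δ)) (fromℕ-δ a b))))
      (+-identityˡ _)

    W-base-pocket : ∀ a j b → W (base a) (pocket j b) ≈ - 𝟙 a (vs j)
    W-base-pocket a j b = off-diagonal (↑ˡ≢↑ʳ a (combine j b)) (Q-base-pocket a j b)

    W-pocket-base : ∀ i a b → W (pocket i a) (base b) ≈ - 𝟙 b (vs i)
    W-pocket-base i a b = off-diagonal (↑ˡ≢↑ʳ b (combine i a) ∘ ≡.sym) (Q-pocket-base i a b)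

    W-pocket-pocket : ∀ i a j b → W (pocket i a) (pocket j b) ≈ 𝟙 i j * N a b
    W-pocket-pocket i a j b = begin
      t * 𝟙 (pocket i a) (pocket j b) - QG (pocket i a) (pocket j b)
        ≈⟨ +-cong (*-congˡ 𝟙-×) (-‿cong Q≈) ⟩
      t * (𝟙 i j * 𝟙 a b) - 𝟙 i j * (𝟙 a b + QH₁ a b)
        ≈⟨ +-cong (solve 3 (λ x y z → x :* (y :* z) := y :* (x :* z)) refl t (𝟙 i j) (𝟙 a b))
                  (-‿distribʳ-* _ _) ⟩
      𝟙 i j * (t * 𝟙 a b) + 𝟙 i j * - (𝟙 a b + QH₁ a b)
        ≈⟨ distribˡ _ _ _ ⟨
      𝟙 i j * (t * 𝟙 a b - (𝟙 a b + QH₁ a b))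
        ≈⟨ *-congˡ (begin
          t * 𝟙 a b - (𝟙 a b + QH₁ a b)        ≈⟨ +-congˡ (-‿+-comm _ _) ⟨
          t * 𝟙 a b + (- 𝟙 a b + - QH₁ a b)    ≈⟨ +-assoc _ _ _ ⟨
          t * 𝟙 a b + - 𝟙 a b + - QH₁ a b      ≈⟨ +-congʳ (+-congˡ (-1*x≈-x _)) ⟨
          t * 𝟙 a b + - 1# * 𝟙 a b + - QH₁ a b ≈⟨ +-congʳ (distribʳ _ _ _) ⟨
          (t - 1#) * 𝟙 a b - QH₁ a b           ∎) ⟩
      𝟙 i j * N a b  ∎
      where
      𝟙-× : 𝟙 (pocket i a) (pocket j b) ≈ 𝟙 i j * 𝟙 a b
      𝟙-× = begin
        𝟙 (pocket i a) (pocket j b)               ≈⟨ fromℕ-δ (pocket i a) (pocket j b) ⟨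
        fromℕ (∑ℕ.δ (pocket i a) (pocket j b))    ≈⟨ reflexive (≡.cong fromℕ (δ-pocket i a j b)) ⟩
        fromℕ (∑ℕ.δ i j ℕ.* ∑ℕ.δ a b)             ≈⟨ trans (fromℕ-* (∑ℕ.δ i j) _)
                                                            (*-cong (fromℕ-δ i j) (fromℕ-δ a b)) ⟩
        𝟙 i j * 𝟙 a b                             ∎
      Q≈ : QG (pocket i a) (pocket j b) ≈ 𝟙 i j * (𝟙 a b + QH₁ a b)
      Q≈ = begin
        QG (pocket i a) (pocket j b)
          ≈⟨ reflexive (≡.cong fromℕ (Q-pocket-pocket i a j b)) ⟩
        fromℕ (∑ℕ.δ i j ℕ.* (∑ℕ.δ a b ℕ.+ signlessLaplacian H₁ a b))
          ≈⟨ fromℕ-* (∑ℕ.δ i j) _ ⟩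
        fromℕ (∑ℕ.δ i j) * fromℕ (∑ℕ.δ a b ℕ.+ signlessLaplacian H₁ a b)
          ≈⟨ *-cong (fromℕ-δ i j) (trans (fromℕ-+ (∑ℕ.δ a b) _) (+-congʳ (fromℕ-δ a b))) ⟩
        𝟙 i j * (𝟙 a b + QH₁ a b)  ∎

    -- This is `- B D⁻¹` with `B` the block from `F` to the pockets and `D` the block diagonal of
    -- copies of `N`: the row of `a` carries `1ᵀ N⁻¹` on each pocket attached at `a`.
    Y : Matrix Carrier n (k ℕ.* p)
    Y a l = 𝟙 a (vs (proj₁ (remQuot {k} p l))) * u (proj₂ (remQuot {k} p l))

    Y-combine : ∀ a i c → Y a (combine i c) ≈ 𝟙 a (vs i) * u c
    Y-combine a i c = reflexive (≡.cong (λ { (j , d) → 𝟙 a (vs j) * u d }) (Fin.remQuot-combine i c))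

    ∑-Y : ∀ a (f : Row (k ℕ.* p)) → ∑ (λ l → Y a l * f l) ≈
          ∑ (λ i → 𝟙 a (vs i) * ∑ (λ c → u c * f (combine i c)))
    ∑-Y a f = trans (∑-combine k _) (∑-cong λ i →
      trans (∑-cong λ c → trans (*-congʳ (Y-combine a i c)) (*-assoc _ _ _)) (sym (*-∑ _ _)))

    Y-clears : ∀ a l → W (base a) (n ↑ʳ l) + ∑ (λ m → Y a m * W (n ↑ʳ m) (n ↑ʳ l)) ≈ 0#
    Y-clears a l with Fin.combine-surjective {k} {p} l
    ... | j , b , ≡.refl = begin
      W (base a) (pocket j b) + ∑ (λ m → Y a m * W (n ↑ʳ m) (pocket j b))
        ≈⟨ +-cong (W-base-pocket a j b) (∑-Y a _) ⟩
      - 𝟙 a (vs j) + ∑ (λ i → 𝟙 a (vs i) * ∑ (λ c → u c * W (pocket i c) (pocket j b)))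
        ≈⟨ +-congˡ (∑-cong inner) ⟩
      - 𝟙 a (vs j) + ∑ (λ i → 𝟙 j i * 𝟙 a (vs i))
        ≈⟨ +-congˡ (∑-𝟙 j _) ⟩
      - 𝟙 a (vs j) + 𝟙 a (vs j)
        ≈⟨ -‿inverseˡ _ ⟩
      0#  ∎
      where
      inner : ∀ i → 𝟙 a (vs i) * ∑ (λ c → u c * W (pocket i c) (pocket j b)) ≈ 𝟙 j i * 𝟙 a (vs i)
      inner i = begin
        𝟙 a (vs i) * ∑ (λ c → u c * W (pocket i c) (pocket j b))
          ≈⟨ *-congˡ (∑-cong λ c → trans (*-congˡ (W-pocket-pocket i c j b))
               (solve 3 (λ x y z → x :* (y :* z) := y :* (x :* z)) refl (u c) (𝟙 i j) (N c b))) ⟩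
        𝟙 a (vs i) * ∑ (λ c → 𝟙 i j * (u c * N c b))
          ≈⟨ *-congˡ (*-∑ _ _) ⟨
        𝟙 a (vs i) * (𝟙 i j * ∑ (λ c → u c * N c b))
          -- Here `uᵀ N = 1ᵀ` turns a whole column of a pocket block into the constant that cancels
          -- the entry `- 1#`.
          ≈⟨ *-congˡ (trans (*-congˡ (inverseRowSum-* N N-sym det≉0 b)) (*-identityʳ _)) ⟩
        𝟙 a (vs i) * 𝟙 i j
          ≈⟨ trans (*-comm _ _) (*-congʳ (𝟙-sym i j)) ⟩
        𝟙 j i * 𝟙 a (vs i)  ∎

    -- The Schur complement in the given vertex order of `F`; `count` stands for the block `𝟙[ k ]`
    -- until the vertices are reordered.
    M′ : Matrix Carrier n n
    M′ a b = t * 𝟙 a b - (QF a b + (fromℕ p + Γ) * (count a * 𝟙 a b))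

    -- The degree gained from the pocket edges and the coronal from the elimination multiply the
    -- same diagonal matrix, hence the single coefficient `fromℕ p + Γ`.
    schur-complement : ∀ a b → W (base a) (base b) + ∑ (λ l → Y a l * W (n ↑ʳ l) (base b)) ≈ M′ a b
    schur-complement a b = begin
      W (base a) (base b) + ∑ (λ l → Y a l * W (n ↑ʳ l) (base b))
        ≈⟨ +-cong (W-base-base a b) (begin
          ∑ (λ l → Y a l * W (n ↑ʳ l) (base b))
            ≈⟨ ∑-Y a _ ⟩
          ∑ (λ i → 𝟙 a (vs i) * ∑ (λ c → u c * W (pocket i c) (base b)))
            ≈⟨ ∑-cong (λ i → *-congˡ (trans
                 (∑-cong λ c → *-congˡ (W-pocket-base i c b)) (sym (∑-* _ _)))) ⟩
          ∑ (λ i → 𝟙 a (vs i) * (∑ u * - 𝟙 b (vs i)))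
            ≈⟨ ∑-cong (λ i → trans (*-congˡ (trans (sym (-‿distribʳ-* _ _)) (-‿distribˡ-* _ _)))
                 (solve 3 (λ x y z → x :* (y :* z) := y :* (x :* z)) refl
                   (𝟙 a (vs i)) (- ∑ u) (𝟙 b (vs i)))) ⟩
          ∑ (λ i → - ∑ u * (𝟙 a (vs i) * 𝟙 b (vs i)))
            ≈⟨ *-∑ _ _ ⟨
          - ∑ u * ∑ (λ i → 𝟙 a (vs i) * 𝟙 b (vs i))
            ≈⟨ *-cong (-‿cong (sym (coronal-∑ QH₁ (t - 1#)))) (∑-pockets a b) ⟩
          - Γ * (count a * 𝟙 a b)
            ≈⟨ -‿distribˡ-* _ _ ⟨
          - (Γ * (count a * 𝟙 a b))  ∎) ⟩
      t * 𝟙 a b - (QF a b + fromℕ p * (count a * 𝟙 a b)) - Γ * (count a * 𝟙 a b)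
        ≈⟨ +-assoc _ _ _ ⟩
      t * 𝟙 a b + (- (QF a b + fromℕ p * (count a * 𝟙 a b)) - Γ * (count a * 𝟙 a b))
        ≈⟨ +-congˡ (trans (-‿+-comm _ _)
             (-‿cong (trans (+-assoc _ _ _) (+-congˡ (sym (distribʳ _ _ _)))))) ⟩
      M′ a b  ∎

    -- The graph `G` keeps its vertex order; `σ` acts only on the Schur complement, whose
    -- determinant is unchanged by a simultaneous reordering of rows and columns.
    charPoly-pocketGraph : ∀ (σ : Permutation′ n) → (∀ i → toℕ (σ ⟨$⟩ˡ vs i) < k) →
      charPoly QG t ≈
      charPoly QH₁ (t - 1#) ^ k * det (t ⊙ 𝟙 ⊖ (reorder σ QF ⊕ (fromℕ p + Γ) ⊙ 𝟙[ k ]))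
    charPoly-pocketGraph σ σ<k = begin
      det W
        ≈⟨ det-schur n W Y Y-clears ⟩
      det (λ a b → W (base a) (base b) + ∑ λ l → Y a l * W (n ↑ʳ l) (base b)) *
      det (λ l m → W (n ↑ʳ l) (n ↑ʳ m))
        ≈⟨ *-cong (det-cong {n} schur-complement) (det-block-diagonal k N _ W-pocket-pocket) ⟩
      det M′ * det N ^ k
        ≈⟨ *-comm _ _ ⟩
      det N ^ k * det M′
        ≈⟨ *-congˡ (trans (sym (det-reorder σ M′)) (det-cong {n} reordered)) ⟩
      det N ^ k * det (t ⊙ 𝟙 ⊖ (reorder σ QF ⊕ (fromℕ p + Γ) ⊙ 𝟙[ k ]))  ∎
      where
      𝟙-σ : ∀ i j → 𝟙 (σ ⟨$⟩ʳ i) (σ ⟨$⟩ʳ j) ≈ 𝟙 i j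
      𝟙-σ = 𝟙-permutation σ
      count-σ : ∀ i j → count (σ ⟨$⟩ʳ i) * 𝟙 i j ≈ 𝟙[ k ] i j
      count-σ i j = trans
        (*-congʳ (trans (reflexive (≡.cong fromℕ (pocketCount-σ vs-injective σ σ<k i)))
                        (fromℕ-bit ⌊ toℕ i ℕ.<? k ⌋)))
        (if-* ⌊ toℕ i ℕ.<? k ⌋)
        where
        if-* : ∀ b → (if b then 1# else 0#) * 𝟙 i j ≈ (if b then 𝟙 i j else 0#)
        if-* true  = *-identityˡ _
        if-* false = zeroˡ _
      reordered : reorder σ M′ ≋ (t ⊙ 𝟙 ⊖ (reorder σ QF ⊕ (fromℕ p + Γ) ⊙ 𝟙[ k ]))
      reordered i j = +-cong (*-congˡ (𝟙-σ i j))
        (-‿cong (+-congˡ (*-congˡ (trans (*-congˡ (𝟙-σ i j)) (count-σ i j)))))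

open DiscreteField ℚ⟨x⟩ using (_≈_; _+_; _*_; _-_; 1#)
open Matrices ℚ⟨x⟩

proposition3p5 :
    ∀ {n k p : ℕ} → 1 ≤ n → 2 ≤ suc p →
    (F : Graph n) (vs : Fin k → Fin n) → Injective _≡_ _≡_ vs →
    (H : Graph (suc p)) (v : Fin (suc p)) → degree H v ≡ p →
    (σ : Permutation′ n) → (∀ i → toℕ (σ ⟨$⟩ˡ vs i) < k) →
    let QG  = fromℕᴹ (signlessLaplacian (pocketGraph F vs H v))
        QH₁ = fromℕᴹ (signlessLaplacian (deleteVertex H v))
        M   = reorder σ (fromℕᴹ (signlessLaplacian F))
                ⊕ (fromℕ p + coronal QH₁ (x - 1#)) ⊙ 𝟙[ k ]
    in charPoly QG x ≈ charPoly QH₁ (x - 1#) ^ k * det (x ⊙ 𝟙 ⊖ M)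
proposition3p5 _ _ F vs vs-injective H v degree≡p =
  charPoly-pocketGraph F vs vs-injective H v degree≡p
    -- As `x` is `embed X`, the degree filtration applies to it and makes `N` invertible.
    (charPoly-shift≉0 (signlessLaplacian (deleteVertex H v)))
  where
  open PocketCharPoly ℚ⟨x⟩ x
  open MonicDeterminants (PolynomialFractions.filtration ℚ-domain)
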